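{- For $n\ge 1$ let $\Gamma_n$ be the directed multigraph whose vertices are the isomorphism classes of connected cubic graphs on $2n$ vertices, with one directed edge from $[g]$ to $[w(g)]$ for every edge $\varepsilon$ of $g$ and each of the two Whitehead moves $w=w^{(1)}_\varepsilon, w^{(2)}_\varepsilon$ on $\varepsilon$. Then $\Gamma_n$ is connected for every $n\ge1$, and $\phi_{out}(\Gamma_n)\to 0$ as $n\to\infty$. Consequently, $\{\Gamma_n\}_{n\in\mathbb N}$ is not a family of outer--expanders.
   Context: A cubic graph is a finite graph in which every vertex has degree $3$; multiple edges and loops are allowed (a loop contributes $2$ to the degree). Whitehead moves: let $\varepsilon$ be a non-loop edge of a cubic graph $g$ with endpoints $u\neq v$. Besides the half-edge of $\varepsilon$, $u$ carries two half-edges $h_a,h_b$ and $v$ carries two half-edges $h_c,h_d$. The Whitehead move $w^{(1)}_\varepsilon$ detaches $h_b$ from $u$ and $h_c$ from $v$ and reattaches $h_c$ to $u$ and $h_b$ to $v$ (so afterwards $u$ carries $h_a,h_c$ and $v$ carries $h_b,h_d$, and $\varepsilon$ still joins $u,v$); $w^{(2)}_\varepsilon$ analogously makes $u$ carry $h_a,h_d$ and $v$ carry $h_b,h_c$. If $\varepsilon$ is a loop, both Whitehead moves on $\varepsilon$ are defined to leave $g$ unchanged (so they produce loops in $\Gamma_n$). Thus every vertex of $\Gamma_n$ has out-degree $2\cdot 3n=6n$. For a directed multigraph $G$ and $S\subseteq V(G)$, let $d(S)=\sum_{v\in S}\deg_{out}(v)$ and let $\partial(S)$ be the set of directed edges $(u,v)$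 with $u\in S$, $v\notin S$. For nonempty proper $S$, the outer-conductance is $\phi_{out}(S)=|\partial(S)|/\min\{d(S),d(V(G)\setminus S)\}$, and $\phi_{out}(G)=\min_S\phi_{out}(S)$. A sequence of directed graphs $G_n$ (with out- and in-degrees growing with the number of vertices) is an outer--expander family if $\phi_{out}(G_n)$ is bounded away from $0$ uniformly in $n$. -}

module Defs where

open import Data.Nat using (ℕ; zero; suc; _+_; _*_; _≤_)
open import Data.Nat.Properties using () renaming (_<?_ to _<ℕ?_)
open import Data.Bool using (Bool; true; false; if_then_else_; not)
open import Data.Fin using (Fin; toℕ)
open import Data.Fin.Properties using (_≟_)
open import Data.Fin.Permutation using (Permutation′; _⟨$⟩ʳ_)
open import Data.Fin.Subset using (Subset; ∣_∣; inside; outside)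
open import Data.Vec using (Vec; []; _∷_; lookup)
open import Data.List using (List; []; _∷_; filter; length; concatMap; map; allFin; _++_)
open import Data.Nat.ListAction using (sum)
open import Data.List.Membership.Propositional using (_∈_)
open import Data.Maybe using (Maybe; just; nothing)
open import Data.Product using (Σ; ∃; _×_; _,_)
open import Data.Integer using (+_)
open import Data.Rational using (ℚ; _/_; _⊓_)
open import Relation.Nullary using (¬_; yes; no; does; ¬?)
open import Relation.Nullary.Decidable using (⌊_⌋)
open import Relation.Binary.PropositionalEquality using (_≡_; _≢_)
open import Relation.Binary.Construct.Closure.ReflexiveTransitive using (Star)
open import Function.Bundles using (_⇔_)

-- Cubic multigraphs on 2n vertices, in half-edge form.
-- Vertices: Fin (2n).  Half-edges: Fin (6n) (= 3 * 2n).
-- 'vert h' is the vertex carrying half-edge h; 'mate h' is the other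
-- half-edge of the edge containing h.  An edge is an orbit {h , mate h};
-- it is a loop iff both half-edges sit at the same vertex.  Multiple
-- edges and loops are allowed.

record RawCubic (n : ℕ) : Set where
  constructor mkRaw
  field
    vert : Fin (6 * n) → Fin (2 * n)
    mate : Fin (6 * n) → Fin (6 * n)
open RawCubic public

degree : ∀ {n} → RawCubic n → Fin (2 * n) → ℕ
degree g v = length (filter (λ h → vert g h ≟ v) (allFin _))

record IsCubic {n : ℕ} (g : RawCubic n) : Set where
  field
    mate-invol  : ∀ h → mate g (mate g h) ≡ h
    mate-nofix  : ∀ h → mate g h ≢ h
    deg3        : ∀ v → degree g v ≡ 3

Adj : ∀ {n} → RawCubic n → Fin (2 * n) → Fin (2 * n) → Set
Adj g u v = ∃ λ h → vert g h ≡ u × vert g (mate g h) ≡ v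

Connected : ∀ {n} → RawCubic n → Set
Connected g = ∀ u v → Star (Adj g) u v

ConnectedCubic : ∀ {n} → RawCubic n → Set
ConnectedCubic g = IsCubic g × Connected g

Iso : ∀ {n} → RawCubic n → RawCubic n → Set
Iso {n} g g′ = Σ (Permutation′ (2 * n)) λ πV → Σ (Permutation′ (6 * n)) λ πH →
  (∀ h → vert g′ (πH ⟨$⟩ʳ h) ≡ πV ⟨$⟩ʳ vert g h) ×
  (∀ h → mate g′ (πH ⟨$⟩ʳ h) ≡ πH ⟨$⟩ʳ mate g h)

-- Whitehead moves on the edge ε = {h , mate h}.
-- u = vert h, v = vert (mate h).  The other half-edges at u, in increasing
-- order, are h_a , h_b; those at v (other than mate h) are h_c , h_d.
-- w⁽¹⁾ moves h_b to v and h_c to u; w⁽²⁾ moves h_b to v and h_d to u.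
-- For a loop both moves are the identity.  (On malformed raw data,
-- where the lists do not have length 2, the move is also the identity;
-- this never happens for cubic graphs.)

othersAt : ∀ {n} → RawCubic n → Fin (6 * n) → List (Fin (6 * n))
othersAt g h = filter (λ e → vert g e ≟ vert g h) (filter (λ e → ¬? (e ≟ h)) (allFin _))

swapMove : ∀ {n} → RawCubic n → Fin (6 * n) → Fin (2 * n) → Fin (6 * n) → Fin (2 * n) → RawCubic n
swapMove g x v y u = mkRaw
  (λ e → if ⌊ e ≟ x ⌋ then v else if ⌊ e ≟ y ⌋ then u else vert g e)
  (mate g)

whitehead : ∀ {n} → Bool → RawCubic n → Fin (6 * n) → RawCubic n
whitehead second g h with vert g h ≟ vert g (mate g h)
... | yes _ = g
... | no _ with othersAt g h | othersAt g (mate g h)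
...   | a ∷ b ∷ [] | c ∷ d ∷ [] =
          swapMove g b (vert g (mate g h)) (if second then d else c) (vert g h)
...   | _ | _ = g

whitehead₁ whitehead₂ : ∀ {n} → RawCubic n → Fin (6 * n) → RawCubic n
whitehead₁ = whitehead false
whitehead₂ = whitehead true

edgeReps : ∀ {n} → RawCubic n → List (Fin (6 * n))
edgeReps g = filter (λ h → toℕ h <ℕ? toℕ (mate g h)) (allFin _)

-- A presentation of the set of isomorphism classes of connected cubic
-- graphs on 2n vertices as Fin k: a classifying map 'cls' (meaningful on
-- connected cubic graphs) and a chosen representative of every class.

record ClassPresentation (n : ℕ) : Set where
  field
    k       : ℕ
    cls     : RawCubic n → Fin k
    rep     : Fin k → RawCubic n
    rep-ok  : ∀ x → ConnectedCubic (rep x)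
    cls-rep : ∀ x → cls (rep x) ≡ x
    cls-iso : ∀ g g′ → ConnectedCubic g → ConnectedCubic g′ →
              (cls g ≡ cls g′) ⇔ Iso g g′

-- Directed multigraphs on Fin k, given by the list of out-neighbours
-- (with multiplicity) of each vertex.

DiGraph : ℕ → Set
DiGraph k = Fin k → List (Fin k)

Γ : ∀ {n} → (P : ClassPresentation n) → DiGraph (ClassPresentation.k P)
Γ P x = concatMap (λ h → cls (whitehead₁ g h) ∷ cls (whitehead₂ g h) ∷ []) (edgeReps g)
  where
  open ClassPresentation P
  g = rep x

Edge : ∀ {k} → DiGraph k → Fin k → Fin k → Set
Edge G x y = y ∈ G x

DiConnected : ∀ {k} → DiGraph k → Set
DiConnected G = ∀ x y → Star (Edge G) x y

inS : ∀ {k} → Subset k → Fin k → Bool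
inS S x = lookup S x

sumOver : ∀ {k} → (Fin k → ℕ) → List (Fin k) → ℕ
sumOver f xs = sum (map f xs)

complement : ∀ {k} → Subset k → Subset k
complement [] = []
complement (b ∷ S) = not b ∷ complement S

vol : ∀ {k} → DiGraph k → Subset k → ℕ
vol G S = sumOver (λ x → length (G x)) (filter (λ x → lookup S x Data.Bool.≟ true) (allFin _))

boundary : ∀ {k} → DiGraph k → Subset k → ℕ
boundary G S = sumOver (λ x → length (filter (λ y → lookup S y Data.Bool.≟ false) (G x)))
                       (filter (λ x → lookup S x Data.Bool.≟ true) (allFin _))

-- a / b as a rational; b = 0 never occurs for the graphs considered
-- (every vertex has out-degree 6n > 0), it is sent to 0
ratio : ℕ → ℕ → ℚ
ratio a zero    = + 0 / 1
ratio a (suc b) = + a / suc b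

phiOutSet : ∀ {k} → DiGraph k → Subset k → ℚ
phiOutSet G S = ratio (boundary G S) (Data.Nat._⊓_ (vol G S) (vol G (complement S)))

allSubsets : (k : ℕ) → List (Subset k)
allSubsets zero    = [] ∷ []
allSubsets (suc k) = map (inside ∷_) (allSubsets k) ++ map (outside ∷_) (allSubsets k)

properNonempty : ∀ {k} → List (Subset k)
properNonempty {k} = filter (λ S → ¬? (∣ S ∣ Data.Nat.≟ 0)) (filter (λ S → ¬? (∣ S ∣ Data.Nat.≟ k)) (allSubsets k))

minimumℚ : List ℚ → Maybe ℚ
minimumℚ []       = nothing
minimumℚ (q ∷ qs) with minimumℚ qs
... | nothing = just q
... | just m  = just (q ⊓ m)

-- φ_out(G) = min over nonempty proper S; 'nothing' if there is no such S
-- (i.e. fewer than 2 vertices)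
phiOut : ∀ {k} → DiGraph k → Maybe ℚ
phiOut G = minimumℚ (map (phiOutSet G) properNonempty)

IsOuterExpanderFamily : (K : ℕ → ℕ) → ((n : ℕ) → DiGraph (K n)) → Set
IsOuterExpanderFamily K G =
  Σ ℚ λ c → (Data.Rational._<_ (+ 0 / 1) c) × (∀ n q → phiOut (G n) ≡ just q → Data.Rational._≤_ c q)

{-# OPTIONS --safe #-}

-- Connectedness.  A Whitehead move swaps two half-edges at the ends of an edge, so conjugating such
-- swaps along a walk swaps two half-edges at the ends of the walk, as long as every vertex of the walk
-- keeps a half-edge to spare.  If a path does not yet span the graph, such a swap brings an edge leaving
-- the path to its head, and the path grows.  Two graphs sharing a spanning path are connected to each
-- other by swaps along that path, each of which corrects the partner of one more half-edge.
--
-- Conductance.  Consider the graphs with a bridge both of whose sides are large, and those with a cut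
-- vertex all three of whose branches are small.  No graph is of both kinds.  A move across an edge whose
-- ends lie in the same part keeps the parts, so at most 12 of the 6n moves on a graph of either kind can
-- leave its kind.  The kind of smaller volume is then at most half of Γ and has conductance at most 2/n.
module Submission where

open import Defs
open import Level using (0ℓ)
open import Function using (_∘_)
open import Function.Bundles using (Equivalence)
open import Induction.WellFounded using (Acc; acc)
open import Data.Bool as Bool using (Bool; true; false; not; if_then_else_)
import Data.Bool.Properties as Boolₚ
open import Data.Empty using (⊥; ⊥-elim)
open import Data.Fin using (Fin; zero; suc; toℕ; fromℕ; fromℕ<; inject₁; combine; remQuot)
open import Data.Fin.Induction using (<-weakInduction)
open import Data.Fin.Patterns using (0F; 1F; 2F; 3F; 4F; 5F)
open import Data.Fin.Permutation using (Permutation′; permutation; _⟨$⟩ʳ_; _⟨$⟩ˡ_; inverseˡ; inverseʳ; flip; _∘ₚ_)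
open import Data.Fin.Properties
  using (_≟_; any?; injective⇒≤; toℕ<n; toℕ-injective; toℕ-inject₁; toℕ-fromℕ; toℕ-fromℕ<; fromℕ<-injective;
         combine-injective; remQuot-combine; combine-remQuot)
open import Data.Fin.Relation.Unary.Top using (view; ‵fromℕ; ‵inj₁; view-fromℕ; view-inject₁)
open import Data.Fin.Subset using (Subset; ∣_∣; inside; outside)
open import Data.Fin.Subset.Properties using (∣p∣≡n⇒p≡⊤; x∈p⇒∣p-x∣<∣p∣)
open import Data.Integer as ℤ using (+_; +<+)
import Data.Integer.Properties as ℤₚ
open import Data.List using (List; []; _∷_; filter; length; map; allFin; _++_; concatMap)
open import Data.List.Properties using (length-map; length-++; length-tabulate; length-filter; filter-++; filter-reject)
open import Data.List.Membership.Propositional using (_∈_; _∉_; lose)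
open import Data.List.Membership.Propositional.Properties
  using (∈-filter⁺; ∈-filter⁻; ∈-allFin; ∈-∃++; ∈-map⁺; ∈-map⁻; ∈-++⁻; ∈-++⁺ˡ; ∈-++⁺ʳ; ∈-concatMap⁺)
import Data.List.Membership.DecPropositional as DecMembership
open import Data.List.Relation.Unary.All as All using ([]; _∷_)
open import Data.List.Relation.Unary.AllPairs using ([]; _∷_)
open import Data.List.Relation.Unary.Any using (here; there)
open import Data.List.Relation.Unary.Unique.Propositional using (Unique)
import Data.List.Relation.Unary.Unique.Propositional.Properties as Uniq
open import Data.Maybe using (just; nothing)
open import Data.Nat as ℕ using (ℕ; zero; suc; _+_; _*_; _∸_; _≤_; _<_; z≤n; s≤s; _≤?_; _<?_)
open import Data.Nat.Induction using (<-wellFounded)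
import Data.Nat.Properties as ℕₚ
open import Data.Product using (Σ; ∃; ∃₂; _×_; _,_; proj₁; proj₂; uncurry)
open import Data.Rational as ℚ using (ℚ; mkℚ; 0ℚ; _⊓_)
import Data.Rational.Properties as ℚₚ
open import Data.Rational.Unnormalised using (mkℚᵘ; *<*)
import Data.Rational.Unnormalised.Properties as ℚᵘₚ
open import Data.Sum using (_⊎_; inj₁; inj₂)
open import Data.Vec using ([]; _∷_; lookup; tabulate)
open import Data.Vec.Properties using (lookup∘tabulate; lookup-replicate; lookup⇒[]=)
open import Relation.Binary using (tri<; tri≈; tri>)
open import Relation.Binary.Construct.Closure.ReflexiveTransitive using (Star; ε; _◅_; _◅◅_; kleisliStar; reverse)
open import Relation.Binary.PropositionalEquality
open import Relation.Nullary using (¬_; Dec; yes; no; does; ¬?)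
open import Relation.Nullary.Decidable using (decidable-stable; dec-true; ¬¬-excluded-middle)
open import Relation.Unary using (Pred; Decidable)

-- A swap of two arbitrary half-edges may disconnect the graph and then leads outside `Γ`. This is
-- why every swap is routed along a walk: each factor of the conjugation crosses one edge and keeps
-- the graph connected. The spare half-edge lends its place while another is carried across the edge
-- and is put back afterwards, so the walk itself never changes. For the conductance the obstacle is
-- the minimum with the volume of the complement: bounding that volume directly would require
-- counting isomorphism classes. Two disjoint kinds with small boundary avoid any count, since each
-- lies in the complement of the other. Sizes of sides and branches are likewise expressed by
-- injections out of or into `Fin`. Neither kind comes with a decision procedure, so the two sets of
-- classes exist only under a double negation. It is removed at the end, because comparing the
-- computed `phiOut` with a rational is decidable.

private variable
  l m n : ℕ
  A B   : Set


-- Transpositions and counting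

abstract
  -- Abstract, so that the nested equality tests never unfold in goals; outside this block only the
  -- three values gathered in `τView` are known.
  τ : Fin m → Fin m → Fin m → Fin m
  τ x y z with z ≟ x
  ... | yes _ = y
  ... | no _ with z ≟ y
  ...   | yes _ = x
  ...   | no _ = z

  τ-left : (x y : Fin m) → τ x y x ≡ y
  τ-left x y with x ≟ x
  ... | yes _ = refl
  ... | no x≢x = ⊥-elim (x≢x refl)

  τ-right : (x y : Fin m) → τ x y y ≡ x
  τ-right x y with y ≟ x
  ... | yes y≡x = y≡x
  ... | no _ with y ≟ y
  ...   | yes _ = refl
  ...   | no y≢y = ⊥-elim (y≢y refl)

  τ-other : (x y : Fin m) {z : Fin m} → z ≢ x → z ≢ y → τ x y z ≡ z
  τ-other x y {z} z≢x z≢y with z ≟ x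
  ... | yes z≡x = ⊥-elim (z≢x z≡x)
  ... | no _ with z ≟ y
  ...   | yes z≡y = ⊥-elim (z≢y z≡y)
  ...   | no _ = refl

data τView (x y z : Fin m) : Set where
  left  : z ≡ x → τ x y z ≡ y → τView x y z
  right : z ≡ y → τ x y z ≡ x → τView x y z
  other : z ≢ x → z ≢ y → τ x y z ≡ z → τView x y z

τ-view : (x y z : Fin m) → τView x y z
τ-view x y z with z ≟ x | z ≟ y
... | yes refl | _ = left refl (τ-left x y)
... | no _ | yes refl = right refl (τ-right x y)
... | no z≢x | no z≢y = other z≢x z≢y (τ-other x y z≢x z≢y)

τ-involutive : (x y z : Fin m) → τ x y (τ x y z) ≡ z
τ-involutive x y z with τ-view x y z
... | left z≡x eq = trans (cong (τ x y) eq) (trans (τ-right x y) (sym z≡x))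
... | right z≡y eq = trans (cong (τ x y) eq) (trans (τ-left x y) (sym z≡y))
... | other _ _ eq = trans (cong (τ x y) eq) eq

τ-injective : (x y : Fin m) {z w : Fin m} → τ x y z ≡ τ x y w → z ≡ w
τ-injective x y {z} {w} eq =
  trans (sym (τ-involutive x y z)) (trans (cong (τ x y) eq) (τ-involutive x y w))

τ-comm : (x y z : Fin m) → τ x y z ≡ τ y x z
τ-comm x y z with τ-view x y z
... | left refl eq = trans eq (sym (τ-right y x))
... | right refl eq = trans eq (sym (τ-left y x))
... | other z≢x z≢y eq = trans eq (sym (τ-other y x z≢y z≢x))

τ-natural : (f : Fin m → Fin l) → (∀ {a b} → f a ≡ f b → a ≡ b) →
  ∀ x y z → f (τ x y z) ≡ τ (f x) (f y) (f z)
τ-natural f f-inj x y z with τ-view x y z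
... | left refl eq = trans (cong f eq) (sym (τ-left (f x) (f y)))
... | right refl eq = trans (cong f eq) (sym (τ-right (f x) (f y)))
... | other z≢x z≢y eq =
  trans (cong f eq) (sym (τ-other (f x) (f y) (z≢x ∘ f-inj) (z≢y ∘ f-inj)))

-- Each element of `xs` deletes one occurrence of itself from `ys`; uniqueness keeps the remaining
-- elements of `xs` inside what is left.
unique-⊆-length : {A : Set} {xs ys : List A} → Unique xs →
  (∀ {x} → x ∈ xs → x ∈ ys) → length xs ≤ length ys
unique-⊆-length [] _ = z≤n
unique-⊆-length {A} {x ∷ xs} (x∉xs ∷ xs!) sub with ∈-∃++ (sub (here refl))
... | ys , zs , refl = subst (suc (length xs) ≤_) (sym len)
      (s≤s (unique-⊆-length xs! sub′))
  where
  len : length (ys ++ x ∷ zs) ≡ suc (length (ys ++ zs))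
  len = trans (length-++ ys) (trans (ℕₚ.+-suc (length ys) (length zs)) (cong suc (sym (length-++ ys))))
  sub′ : ∀ {y} → y ∈ xs → y ∈ ys ++ zs
  sub′ {y} y∈xs with ∈-++⁻ ys (sub (there y∈xs))
  ... | inj₁ y∈ys = ∈-++⁺ˡ y∈ys
  ... | inj₂ (here refl) = ⊥-elim (All.lookup x∉xs y∈xs refl)
  ... | inj₂ (there y∈zs) = ∈-++⁺ʳ ys y∈zs

count : {P : Pred (Fin m) 0ℓ} → Decidable P → ℕ
count P? = length (filter P? (allFin _))

module _ {P : Pred (Fin m) 0ℓ} (P? : Decidable P) where

  ∈-count : ∀ {i} → P i → i ∈ filter P? (allFin m)
  ∈-count Pi = ∈-filter⁺ P? (∈-allFin _) Pi

  count-∈ : ∀ {i} → i ∈ filter P? (allFin m) → P i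
  count-∈ i∈ = proj₂ (∈-filter⁻ P? {xs = allFin m} i∈)

  count-unique : Unique (filter P? (allFin m))
  count-unique = Uniq.filter⁺ P? (Uniq.allFin⁺ m)

  count-≤-length : ∀ ys → (∀ i → P i → i ∈ ys) → count P? ≤ length ys
  count-≤-length ys cover = unique-⊆-length count-unique (λ i∈ → cover _ (count-∈ i∈))

  length-≤-count : ∀ {ys} → Unique ys → (∀ {i} → i ∈ ys → P i) → length ys ≤ count P?
  length-≤-count ys! sat = unique-⊆-length ys! (λ i∈ → ∈-count (sat i∈))

count-injective : {P : Pred (Fin m) 0ℓ} (P? : Decidable P) {Q : Pred (Fin l) 0ℓ} (Q? : Decidable Q)
  (f : Fin m → Fin l) → (∀ {a b} → f a ≡ f b → a ≡ b) →
  (∀ i → P i → Q (f i)) → count P? ≤ count Q?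
count-injective P? Q? f f-inj imp =
  subst (_≤ count Q?) (length-map f (filter P? (allFin _)))
    (length-≤-count Q? (Uniq.map⁺ f-inj (count-unique P?)) sat)
  where
  sat : ∀ {i} → i ∈ map f (filter P? (allFin _)) → _
  sat i∈ with ∈-map⁻ f i∈
  ... | j , j∈ , refl = imp j (count-∈ P? j∈)

count-< : {P Q : Pred (Fin m) 0ℓ} (P? : Decidable P) (Q? : Decidable Q) →
  (∀ i → P i → Q i) → ∀ i → Q i → ¬ P i → count P? < count Q?
count-< {P = P} P? Q? imp i Qi ¬Pi = length-≤-count Q? {i ∷ filter P? (allFin _)}
  (All.tabulate (λ j∈ i≡j → ¬Pi (subst P (sym i≡j) (count-∈ P? j∈))) ∷ count-unique P?) sat
  where
  sat : ∀ {j} → j ∈ i ∷ filter P? (allFin _) → _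
  sat (here refl) = Qi
  sat (there j∈) = imp _ (count-∈ P? j∈)

-- Whitehead moves as swaps of half-edges

infix 4 _≗ᵍ_
_≗ᵍ_ : RawCubic n → RawCubic n → Set
g ≗ᵍ g′ = (∀ e → vert g e ≡ vert g′ e) × (∀ e → mate g e ≡ mate g′ e)

infix 20 _[_↔_]
-- As a precomposition with a transposition, a move needs no mention of its target vertices, and
-- relations between sequences of moves become identities between transpositions.
_[_↔_] : RawCubic n → Fin (6 * n) → Fin (6 * n) → RawCubic n
g [ b ↔ c ] = mkRaw (vert g ∘ τ b c) (mate g)

τ-perm : Fin m → Fin m → Permutation′ m
τ-perm x y = permutation (τ x y) (τ x y) (τ-involutive x y) (τ-involutive x y)

perm-injective : (π : Permutation′ m) {i j : Fin m} → π ⟨$⟩ʳ i ≡ π ⟨$⟩ʳ j → i ≡ j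
perm-injective π eq = trans (sym (inverseˡ π)) (trans (cong (π ⟨$⟩ˡ_) eq) (inverseˡ π))

id-perm : Permutation′ m
id-perm = permutation (λ i → i) (λ i → i) (λ _ → refl) (λ _ → refl)

≗ᵍ⇒Iso : (g g′ : RawCubic n) → g ≗ᵍ g′ → Iso g g′
≗ᵍ⇒Iso _ _ (v≗ , m≗) = id-perm , id-perm , (λ h → sym (v≗ h)) , (λ h → sym (m≗ h))

≗ᵍ-sym : (g g′ : RawCubic n) → g ≗ᵍ g′ → g′ ≗ᵍ g
≗ᵍ-sym _ _ (v≗ , m≗) = (λ h → sym (v≗ h)) , (λ h → sym (m≗ h))

Iso-sym : (g g′ : RawCubic n) → Iso g g′ → Iso g′ g
Iso-sym g g′ (πV , πH , v≡ , m≡) = flip πV , flip πH ,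
  (λ h → trans (sym (inverseˡ πV)) (cong (πV ⟨$⟩ˡ_) (trans (sym (v≡ _)) (cong (vert g′) (inverseʳ πH))))) ,
  (λ h → trans (sym (inverseˡ πH)) (cong (πH ⟨$⟩ˡ_) (trans (sym (m≡ _)) (cong (mate g′) (inverseʳ πH)))))

Iso-trans : (g g′ g″ : RawCubic n) → Iso g g′ → Iso g′ g″ → Iso g g″
Iso-trans _ _ _ (πV , πH , v≡ , m≡) (ρV , ρH , w≡ , l≡) = πV ∘ₚ ρV , πH ∘ₚ ρH ,
  (λ h → trans (w≡ _) (cong (ρV ⟨$⟩ʳ_) (v≡ h))) ,
  (λ h → trans (l≡ _) (cong (ρH ⟨$⟩ʳ_) (m≡ h)))

-- A transposition conjugated by a permutation is the transposition of the images, so the same two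
-- permutations serve. This carries a swap to the chosen representative of a class.
Iso-swap : (g g′ : RawCubic n) (i : Iso g g′) → ∀ b c →
  let πH = proj₁ (proj₂ i) in Iso (g [ b ↔ c ]) (g′ [ πH ⟨$⟩ʳ b ↔ πH ⟨$⟩ʳ c ])
Iso-swap _ g′ (πV , πH , v≡ , m≡) b c = πV , πH ,
  (λ h → trans (cong (vert g′) (sym (τ-natural (πH ⟨$⟩ʳ_) (perm-injective πH) b c h))) (v≡ _)) ,
  m≡

≗ᵍ-connectedCubic : {g g′ : RawCubic n} → g ≗ᵍ g′ → ConnectedCubic g → ConnectedCubic g′
≗ᵍ-connectedCubic {g = g} {g′} (v≗ , m≗) (cubic , conn) = record
  { mate-invol = λ h → trans (sym (trans (cong (mate g) (m≗ h)) (m≗ _))) (mate-invol h)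
  ; mate-nofix = λ h eq → mate-nofix h (trans (m≗ h) eq)
  ; deg3 = λ v → trans (ℕₚ.≤-antisym
      (count-injective _ _ (λ h → h) (λ eq → eq) (λ h → trans (v≗ h)))
      (count-injective _ _ (λ h → h) (λ eq → eq) (λ h → trans (sym (v≗ h))))) (deg3 v)
  } , λ u v → kleisliStar (λ w → w) adj (conn u v)
  where
  open IsCubic cubic
  adj : ∀ {u v} → Adj g u v → Star (Adj g′) u v
  adj (h , refl , refl) = (h , sym (v≗ h) , trans (cong (vert g′) (sym (m≗ h))) (sym (v≗ _))) ◅ ε

-- These conditions make the exchange of `b` and `c` a Whitehead move up to isomorphism, whichever
-- of the two free half-edges at each end they are.
record Adjacent (g : RawCubic n) (h b c : Fin (6 * n)) : Set where
  field
    nonloop : vert g h ≢ vert g (mate g h)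
    b-at    : vert g b ≡ vert g h
    b≢h     : b ≢ h
    c-at    : vert g c ≡ vert g (mate g h)
    c≢h′    : c ≢ mate g h

  b≢c : b ≢ c
  b≢c refl = nonloop (trans (sym b-at) c-at)
  h≢c : h ≢ c
  h≢c refl = nonloop c-at
  h′≢b : mate g h ≢ b
  h′≢b eq = nonloop (sym (trans (cong (vert g) eq) b-at))

module _ {g : RawCubic n} (cc : ConnectedCubic g) where
  open IsCubic (proj₁ cc)

  -- The edge of `h` stays in place, so a half-edge that has changed ends is reached from its old
  -- vertex across that edge, and every old edge becomes a short walk. Degrees persist because a
  -- transposition permutes the half-edges.
  swap-connectedCubic : ∀ {h b c} → Adjacent g h b c → ConnectedCubic (g [ b ↔ c ])
  swap-connectedCubic {h} {b} {c} adjacent = record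
    { mate-invol = mate-invol
    ; mate-nofix = mate-nofix
    ; deg3 = λ v → trans (ℕₚ.≤-antisym
        (count-injective _ _ (τ b c) (τ-injective b c) (λ _ eq → eq))
        (count-injective _ _ (τ b c) (τ-injective b c)
          (λ e eq → trans (cong (vert g) (τ-involutive b c e)) eq))) (deg3 v)
    } , λ u v → kleisliStar (λ w → w) adj (proj₂ cc u v)
    where
    open Adjacent adjacent
    g′ = g [ b ↔ c ]
    along : Adj g′ (vert g h) (vert g (mate g h))
    along = h , cong (vert g) (τ-other b c (λ eq → b≢h (sym eq)) h≢c)
              , cong (vert g) (τ-other b c h′≢b (λ eq → c≢h′ (sym eq)))
    along⁻ : Adj g′ (vert g (mate g h)) (vert g h)
    along⁻ = mate g h , proj₂ (proj₂ along) , trans (cong (vert g′) (mate-invol h)) (proj₁ (proj₂ along))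
    move : ∀ e → Star (Adj g′) (vert g e) (vert g′ e)
    move e with τ-view b c e
    ... | left refl eq = subst₂ (Star (Adj g′)) (sym b-at) (trans (sym c-at) (cong (vert g) (sym eq))) (along ◅ ε)
    ... | right refl eq = subst₂ (Star (Adj g′)) (sym c-at) (trans (sym b-at) (cong (vert g) (sym eq))) (along⁻ ◅ ε)
    ... | other _ _ eq = subst (Star (Adj g′) (vert g e)) (cong (vert g) (sym eq)) ε
    move⁻ : ∀ e → Star (Adj g′) (vert g′ e) (vert g e)
    move⁻ e with τ-view b c e
    ... | left refl eq = subst₂ (Star (Adj g′)) (trans (sym c-at) (cong (vert g) (sym eq))) (sym b-at) (along⁻ ◅ ε)
    ... | right refl eq = subst₂ (Star (Adj g′)) (trans (sym b-at) (cong (vert g) (sym eq))) (sym c-at) (along ◅ ε)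
    ... | other _ _ eq = subst (λ v → Star (Adj g′) v (vert g e)) (cong (vert g) (sym eq)) ε
    adj : ∀ {u v} → Adj g u v → Star (Adj g′) u v
    adj (e , refl , refl) = move e ◅◅ (e , refl , refl) ◅ move⁻ (mate g e)

record Others (g : RawCubic n) (h a b : Fin (6 * n)) : Set where
  field
    a≢b  : a ≢ b
    a≢h  : a ≢ h
    b≢h  : b ≢ h
    a-at : vert g a ≡ vert g h
    b-at : vert g b ≡ vert g h
    only : ∀ e → vert g e ≡ vert g h → e ≡ h ⊎ e ≡ a ⊎ e ≡ b

Others-flip : {g : RawCubic n} {h a b : Fin (6 * n)} → Others g h a b → Others g h b a
Others-flip {n} {g} {h} {a} {b} o = record
  { a≢b = λ eq → a≢b (sym eq) ; a≢h = b≢h ; b≢h = a≢h ; a-at = b-at ; b-at = a-at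
  ; only = λ e eq → flip-only (only e eq) }
  where
  open Others o
  flip-only : ∀ {e} → e ≡ h ⊎ e ≡ a ⊎ e ≡ b → e ≡ h ⊎ e ≡ b ⊎ e ≡ a
  flip-only (inj₁ eq) = inj₁ eq
  flip-only (inj₂ (inj₁ eq)) = inj₂ (inj₂ eq)
  flip-only (inj₂ (inj₂ eq)) = inj₂ (inj₁ eq)

module _ {g : RawCubic n} (cubic : IsCubic g) where
  open IsCubic cubic

  -- With `h` added, the list enumerates the half-edges at the vertex without repetition, so degree
  -- 3 leaves exactly two entries.
  othersAt-pair : ∀ h → ∃₂ λ a b → othersAt g h ≡ a ∷ b ∷ [] × Others g h a b
  othersAt-pair h = pair (othersAt g h) refl
    where
    at? = λ e → vert g e ≟ vert g h
    not? = λ e → ¬? (e ≟ h)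
    sound : ∀ {e} → e ∈ othersAt g h → e ≢ h × vert g e ≡ vert g h
    sound e∈ with ∈-filter⁻ at? {xs = filter not? (allFin _)} e∈
    ... | e∈′ , at = proj₂ (∈-filter⁻ not? {xs = allFin _} e∈′) , at
    complete : ∀ {e} → e ≢ h → vert g e ≡ vert g h → e ∈ othersAt g h
    complete e≢h at = ∈-filter⁺ at? (∈-filter⁺ not? (∈-allFin _) e≢h) at
    unique : Unique (othersAt g h)
    unique = Uniq.filter⁺ at? (Uniq.filter⁺ not? (Uniq.allFin⁺ _))
    h∷ : ∀ e → vert g e ≡ vert g h → e ∈ h ∷ othersAt g h
    h∷ e at with e ≟ h
    ... | yes refl = here refl
    ... | no e≢h = there (complete e≢h at)
    ∈-at : ∀ {e} → e ∈ h ∷ othersAt g h → vert g e ≡ vert g h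
    ∈-at (here refl) = refl
    ∈-at (there e∈) = proj₂ (sound e∈)
    len : suc (length (othersAt g h)) ≡ 3
    len = trans (ℕₚ.≤-antisym
      (length-≤-count at? {h ∷ othersAt g h} (All.tabulate (λ e∈ h≡e → proj₁ (sound e∈) (sym h≡e)) ∷ unique) ∈-at)
      (count-≤-length at? (h ∷ othersAt g h) h∷)) (deg3 (vert g h))
    pair : ∀ es → othersAt g h ≡ es → ∃₂ λ a b → othersAt g h ≡ a ∷ b ∷ [] × Others g h a b
    pair es eq with subst (λ es → suc (length es) ≡ 3) eq len | subst Unique eq unique
      | (λ {e} → subst (λ es → e ∈ es → e ≢ h × vert g e ≡ vert g h) eq (sound {e}))
      | (λ e → subst (λ es → vert g e ≡ vert g h → e ∈ h ∷ es) eq (h∷ e))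
    pair (a ∷ b ∷ []) eq | refl | (a≢b ∷ []) ∷ _ | snd | cmp = a , b , eq , record
      { a≢b = a≢b
      ; a≢h = proj₁ (snd (here refl)) ; b≢h = proj₁ (snd (there (here refl)))
      ; a-at = proj₂ (snd (here refl)) ; b-at = proj₂ (snd (there (here refl)))
      ; only = λ e at → listed (cmp e at) }
      where
      listed : ∀ {e} → e ∈ h ∷ a ∷ b ∷ [] → e ≡ h ⊎ e ≡ a ⊎ e ≡ b
      listed (here eq) = inj₁ eq
      listed (there (here eq)) = inj₂ (inj₁ eq)
      listed (there (there (here eq))) = inj₂ (inj₂ eq)

  swapMove-≗ᵍ : ∀ b c v u → vert g b ≡ u → vert g c ≡ v → swapMove g b v c u ≗ᵍ g [ b ↔ c ]
  swapMove-≗ᵍ b c _ _ refl refl = moved , λ _ → refl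
    where
    moved : ∀ e → vert (swapMove g b (vert g c) c (vert g b)) e ≡ vert g (τ b c e)
    moved e with e ≟ b
    ... | yes refl = cong (vert g) (sym (τ-left b c))
    ... | no e≢b with e ≟ c
    ...   | yes refl = cong (vert g) (sym (τ-right b c))
    ...   | no e≢c = cong (vert g) (sym (τ-other b c e≢b e≢c))

  whitehead-loop : ∀ s h → vert g h ≡ vert g (mate g h) → whitehead s g h ≡ g
  whitehead-loop s h loop with vert g h ≟ vert g (mate g h)
  ... | yes _ = refl
  ... | no nonloop = ⊥-elim (nonloop loop)

  -- The list matching inside `whitehead` is opened only here. The half-edge `b` moves in both
  -- cases, and `s` selects its partner.
  whitehead-swaps : ∀ h → vert g h ≢ vert g (mate g h) → ∃₂ λ a b → ∃₂ λ c d →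
    Others g h a b × Others g (mate g h) c d ×
    (∀ s → whitehead s g h ≗ᵍ g [ b ↔ if s then d else c ])
  whitehead-swaps h nonloop with othersAt-pair h | othersAt-pair (mate g h)
  ... | a , b , eq₁ , o₁ | c , d , eq₂ , o₂ = a , b , c , d , o₁ , o₂ , moved
    where
    moved : ∀ s → whitehead s g h ≗ᵍ g [ b ↔ if s then d else c ]
    moved s with vert g h ≟ vert g (mate g h)
    ... | yes loop = ⊥-elim (nonloop loop)
    moved false | no _ rewrite eq₁ | eq₂ = swapMove-≗ᵍ b c _ _ (Others.b-at o₁) (Others.a-at o₂)
    moved true  | no _ rewrite eq₁ | eq₂ = swapMove-≗ᵍ b d _ _ (Others.b-at o₁) (Others.b-at o₂)

  module _ {h : Fin (6 * n)} (nonloop : vert g h ≢ vert g (mate g h)) where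

    adjacent : ∀ {a b c d} → Others g h a b → Others g (mate g h) c d → Adjacent g h b d
    adjacent o₁ o₂ = record { nonloop = nonloop ; b-at = Others.b-at o₁ ; b≢h = Others.b≢h o₁
      ; c-at = Others.b-at o₂ ; c≢h′ = Others.b≢h o₂ }

    -- Exchanging the two ends of the edge turns one swap into the complementary one.
    Iso-complement : ∀ {a b c d} → Others g h a b → Others g (mate g h) c d →
      Iso (g [ a ↔ c ]) (g [ b ↔ d ])
    Iso-complement {a} {b} {c} {d} o₁ o₂ = τ-perm u v , τ-perm h h′ , vert-eq , λ e →
        trans (τ-natural (mate g) mate-injective h h′ e)
          (trans (cong (λ z → τ h′ z (mate g e)) (mate-invol h)) (τ-comm h′ h (mate g e)))
      where
      h′ = mate g h
      u = vert g h
      v = vert g h′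
      module O₁ = Others o₁
      module O₂ = Others o₂
      module A₁ = Adjacent (adjacent (Others-flip o₁) (Others-flip o₂))
      module A₂ = Adjacent (adjacent o₁ o₂)
      module A₃ = Adjacent (adjacent o₁ (Others-flip o₂))
      module A₄ = Adjacent (adjacent (Others-flip o₁) o₂)
      mate-injective : ∀ {x y} → mate g x ≡ mate g y → x ≡ y
      mate-injective eq = trans (sym (mate-invol _)) (trans (cong (mate g) eq) (mate-invol _))
      chain : ∀ e {e₁ e₂ e₃ w} → τ h h′ e ≡ e₁ → τ b d e₁ ≡ e₂ → τ a c e ≡ e₃ →
        vert g e₂ ≡ τ u v w → vert g e₃ ≡ w →
        vert g (τ b d (τ h h′ e)) ≡ τ u v (vert g (τ a c e))
      chain _ refl refl refl p refl = p
      to-u : ∀ {e₂} → vert g e₂ ≡ u → vert g e₂ ≡ τ u v v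
      to-u p = trans p (sym (τ-right u v))
      to-v : ∀ {e₂} → vert g e₂ ≡ v → vert g e₂ ≡ τ u v u
      to-v p = trans p (sym (τ-left u v))
      infix 0 _⁻
      _⁻ : ∀ {x y : Fin (6 * n)} → x ≢ y → y ≢ x
      (p ⁻) eq = p (sym eq)
      vert-eq : ∀ e → vert g (τ b d (τ h h′ e)) ≡ τ u v (vert g (τ a c e))
      vert-eq e = cases (e ≟ h) (e ≟ h′) (vert g e ≟ u) (vert g e ≟ v)
        where
        Goal = vert g (τ b d (τ h h′ e)) ≡ τ u v (vert g (τ a c e))
        at-u : e ≢ h → e ≢ h′ → e ≡ h ⊎ e ≡ a ⊎ e ≡ b → Goal
        at-u e≢h e≢h′ (inj₁ eq) = ⊥-elim (e≢h eq)
        at-u e≢h e≢h′ (inj₂ (inj₁ refl)) = chain a (τ-other h h′ e≢h e≢h′) (τ-other b d O₁.a≢b A₄.b≢c)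
                (τ-left a c) (to-u O₁.a-at) O₂.a-at
        at-u e≢h e≢h′ (inj₂ (inj₂ refl)) = chain b (τ-other h h′ e≢h e≢h′) (τ-left b d)
                (τ-other a c (O₁.a≢b ⁻) A₃.b≢c) (to-v O₂.b-at) O₁.b-at
        at-v : e ≢ h → e ≢ h′ → e ≡ h′ ⊎ e ≡ c ⊎ e ≡ d → Goal
        at-v e≢h e≢h′ (inj₁ eq) = ⊥-elim (e≢h′ eq)
        at-v e≢h e≢h′ (inj₂ (inj₁ refl)) = chain c (τ-other h h′ e≢h e≢h′) (τ-other b d (A₃.b≢c ⁻) O₂.a≢b)
                (τ-right a c) (to-v O₂.a-at) O₁.a-at
        at-v e≢h e≢h′ (inj₂ (inj₂ refl)) = chain d (τ-other h h′ e≢h e≢h′) (τ-right b d)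
                (τ-other a c (A₄.b≢c ⁻) (O₂.a≢b ⁻)) (to-u O₁.b-at) O₂.b-at
        cases : Dec (e ≡ h) → Dec (e ≡ h′) → Dec (vert g e ≡ u) → Dec (vert g e ≡ v) → Goal
        cases (yes refl) _ _ _ = chain h (τ-left h h′) (τ-other b d A₂.h′≢b (A₂.c≢h′ ⁻))
              (τ-other a c (A₁.b≢h ⁻) A₁.h≢c) (to-v refl) refl
        cases (no _) (yes refl) _ _ = chain h′ (τ-right h h′) (τ-other b d (A₂.b≢h ⁻) A₂.h≢c)
              (τ-other a c A₁.h′≢b (A₁.c≢h′ ⁻)) (to-u refl) refl
        cases (no e≢h) (no e≢h′) (yes at) _ = at-u e≢h e≢h′ (O₁.only e at)
        cases (no e≢h) (no e≢h′) (no _) (yes at) = at-v e≢h e≢h′ (O₂.only e at)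
        cases (no e≢h) (no e≢h′) (no ¬u) (no ¬v) = chain e (τ-other h h′ e≢h e≢h′)
          (τ-other b d (λ { refl → ¬u O₁.b-at }) (λ { refl → ¬v O₂.b-at }))
          (τ-other a c (λ { refl → ¬u O₁.a-at }) (λ { refl → ¬v O₂.a-at }))
          (sym (τ-other u v ¬u ¬v)) refl

    -- Of the four swaps of `a` or `b` with `c` or `d`, the two moves realise only those with `b`.
    -- `Iso-complement` turns a swap of `a` with one partner into the swap of `b` with the other.
    swap-whitehead : ∀ {b c} → Adjacent g h b c → ∃ λ s → Iso (g [ b ↔ c ]) (whitehead s g h)
    swap-whitehead {x} {y} adj with whitehead-swaps h nonloop
    ... | a , b , c , d , o₁ , o₂ , moved = by (Others.only o₁ x (Adjacent.b-at adj)) (Others.only o₂ y (Adjacent.c-at adj))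
      where
      from : ∀ s → Iso (g [ b ↔ if s then d else c ]) (whitehead s g h)
      from s = ≗ᵍ⇒Iso _ (whitehead s g h) (≗ᵍ-sym (whitehead s g h) (g [ b ↔ if s then d else c ]) (moved s))
      by : x ≡ h ⊎ x ≡ a ⊎ x ≡ b → y ≡ mate g h ⊎ y ≡ c ⊎ y ≡ d → ∃ λ s → Iso (g [ x ↔ y ]) (whitehead s g h)
      by (inj₁ eq) _ = ⊥-elim (Adjacent.b≢h adj eq)
      by (inj₂ _) (inj₁ eq) = ⊥-elim (Adjacent.c≢h′ adj eq)
      by (inj₂ (inj₂ refl)) (inj₂ (inj₁ refl)) = false , from false
      by (inj₂ (inj₂ refl)) (inj₂ (inj₂ refl)) = true , from true
      by (inj₂ (inj₁ refl)) (inj₂ (inj₁ refl)) = true ,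
            Iso-trans (g [ a ↔ c ]) (g [ b ↔ d ]) (whitehead true g h) (Iso-complement o₁ o₂) (from true)
      by (inj₂ (inj₁ refl)) (inj₂ (inj₂ refl)) = false ,
            Iso-trans (g [ a ↔ d ]) (g [ b ↔ c ]) (whitehead false g h) (Iso-complement o₁ (Others-flip o₂)) (from false)

whitehead-connectedCubic : {g : RawCubic n} → ConnectedCubic g → ∀ s h → ConnectedCubic (whitehead s g h)
whitehead-connectedCubic {g = g} cc s h = go (vert g h ≟ vert g (mate g h))
  where
  go : Dec (vert g h ≡ vert g (mate g h)) → ConnectedCubic (whitehead s g h)
  go (yes loop) rewrite whitehead-loop (proj₁ cc) s h loop = cc
  go (no nonloop) with whitehead-swaps (proj₁ cc) h nonloop
  ... | a , b , c , d , o₁ , o₂ , moved = ≗ᵍ-connectedCubic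
    (≗ᵍ-sym (whitehead s g h) (g [ b ↔ if s then d else c ]) (moved s))
    (swap-connectedCubic cc (adj s))
    where
    adj : ∀ s → Adjacent g h b (if s then d else c)
    adj false = adjacent (proj₁ cc) nonloop o₁ (Others-flip o₂)
    adj true = adjacent (proj₁ cc) nonloop o₁ o₂

-- Swaps along walks

Iso-connectedCubic : (g g′ : RawCubic n) → Iso g g′ → ConnectedCubic g → ConnectedCubic g′
Iso-connectedCubic g g′ (πV , πH , v≡ , m≡) (cubic , conn) = record
  { mate-invol = λ h → via h λ e → trans (cong (mate g′) (m≡ e)) (trans (m≡ _) (cong (πH ⟨$⟩ʳ_) (mate-invol e)))
  ; mate-nofix = λ h eq → mate-nofix (πH ⟨$⟩ˡ h) (perm-injective πH
      (trans (sym (m≡ _)) (trans (cong (mate g′) (inverseʳ πH)) (trans eq (sym (inverseʳ πH))))))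
  ; deg3 = λ v → trans (ℕₚ.≤-antisym
      (count-injective _ _ (πH ⟨$⟩ˡ_) (perm-injective (Data.Fin.Permutation.flip πH)) λ h eq →
        perm-injective πV (trans (sym (v≡ _)) (trans (cong (vert g′) (inverseʳ πH)) (trans eq (sym (inverseʳ πV))))))
      (count-injective _ _ (πH ⟨$⟩ʳ_) (perm-injective πH) λ h eq →
        trans (v≡ h) (trans (cong (πV ⟨$⟩ʳ_) eq) (inverseʳ πV)))) (deg3 (πV ⟨$⟩ˡ v))
  } , λ u v → subst₂ (Star (Adj g′)) (inverseʳ πV) (inverseʳ πV) (walk (conn (πV ⟨$⟩ˡ u) (πV ⟨$⟩ˡ v)))
  where
  open IsCubic cubic
  via : ∀ h → (∀ e → mate g′ (mate g′ (πH ⟨$⟩ʳ e)) ≡ πH ⟨$⟩ʳ e) → mate g′ (mate g′ h) ≡ h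
  via h p = subst (λ h → mate g′ (mate g′ h) ≡ h) (inverseʳ πH) (p (πH ⟨$⟩ˡ h))
  walk : ∀ {u v} → Star (Adj g) u v → Star (Adj g′) (πV ⟨$⟩ʳ u) (πV ⟨$⟩ʳ v)
  walk ε = ε
  walk ((h , refl , refl) ◅ w) = (πH ⟨$⟩ʳ h , v≡ h , trans (cong (vert g′) (m≡ h)) (v≡ _)) ◅ walk w

-- A missed value together with the image would give `suc a` distinct elements of `Fin b`.
injective⇒surjective : ∀ {a b} → b ≤ a → (f : Fin a → Fin b) → (∀ {i j} → f i ≡ f j → i ≡ j) →
  ∀ y → ∃ λ i → f i ≡ y
injective⇒surjective {a} {b} b≤a f f-inj y with any? (λ i → f i ≟ y)
... | yes found = found
... | no missed = ⊥-elim (ℕₚ.<⇒≱ (ℕₚ.≤-trans too-many (ℕₚ.≤-reflexive (length-tabulate {n = b} _))) b≤a)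
  where
  too-many : suc a ≤ length (allFin b)
  too-many = subst (λ l → suc l ≤ length (allFin b))
    (trans (length-map f (allFin a)) (length-tabulate {n = a} _))
    (unique-⊆-length {xs = y ∷ map f (allFin a)} (All.tabulate fresh ∷ Uniq.map⁺ f-inj (Uniq.allFin⁺ a)) (λ _ → ∈-allFin _))
    where
    fresh : ∀ {z} → z ∈ map f (allFin a) → y ≢ z
    fresh z∈ y≡z with ∈-map⁻ f z∈
    ... | i , _ , refl = missed (i , sym y≡z)

module Reach {n : ℕ} (P : ClassPresentation n) where
  open ClassPresentation P

  cls-≡ : ∀ g g′ → ConnectedCubic g → Iso g g′ → cls g ≡ cls g′
  cls-≡ g g′ cc i = Equivalence.from (cls-iso g g′ cc (Iso-connectedCubic g g′ i cc)) i

  rep-iso : ∀ g → ConnectedCubic g → Iso g (rep (cls g))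
  rep-iso g cc = Equivalence.to (cls-iso g _ cc (rep-ok _)) (sym (cls-rep (cls g)))

  Adjacent-flip : ∀ {g h b c} → IsCubic g → Adjacent g h b c → Adjacent {n} g (mate g h) c b
  Adjacent-flip {g} {h} cubic a = record
    { nonloop = λ eq → nonloop (sym (trans eq (cong (vert g) (mate-invol h))))
    ; b-at = c-at ; b≢h = c≢h′
    ; c-at = trans b-at (sym (cong (vert g) (mate-invol h)))
    ; c≢h′ = λ eq → b≢h (trans eq (mate-invol h)) }
    where
    open Adjacent a
    open IsCubic cubic

  Adjacent-Iso : ∀ g g′ {h b c} (i : Iso g g′) → let πH = proj₁ (proj₂ i) in
    Adjacent g h b c → Adjacent {n} g′ (πH ⟨$⟩ʳ h) (πH ⟨$⟩ʳ b) (πH ⟨$⟩ʳ c)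
  Adjacent-Iso g g′ {h} (πV , πH , v≡ , m≡) a = record
    { nonloop = λ eq → nonloop (perm-injective πV (trans (sym (v≡ h)) (trans eq end)))
    ; b-at = trans (v≡ _) (trans (cong (πV ⟨$⟩ʳ_) b-at) (sym (v≡ h)))
    ; b≢h = b≢h ∘ perm-injective πH
    ; c-at = trans (v≡ _) (trans (cong (πV ⟨$⟩ʳ_) c-at) (sym end))
    ; c≢h′ = λ eq → c≢h′ (perm-injective πH (trans eq (m≡ h))) }
    where
    open Adjacent a
    end : vert g′ (mate g′ (πH ⟨$⟩ʳ h)) ≡ πV ⟨$⟩ʳ vert g (mate g h)
    end = trans (cong (vert g′) (m≡ h)) (v≡ _)

  whitehead-edge : ∀ x s {h} → toℕ h < toℕ (mate (rep x) h) → Edge (Γ P) x (cls (whitehead s (rep x) h))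
  whitehead-edge x s {h} h< = ∈-concatMap⁺ _ (lose (∈-filter⁺ _ (∈-allFin h) h<) (listed s))
    where
    g = rep x
    listed : ∀ s → cls (whitehead s g h) ∈ cls (whitehead₁ g h) ∷ cls (whitehead₂ g h) ∷ []
    listed false = here refl
    listed true = there (here refl)

  -- Edges of `Γ P` are read off the representative of the class, and only from the smaller
  -- half-edge of each edge. The swap is therefore carried to the representative and, if `h` lands
  -- on the larger half-edge, reread from its mate with `b` and `c` exchanged.
  swap-edge : ∀ g {h b c} → ConnectedCubic g → Adjacent g h b c → Edge (Γ P) (cls g) (cls (g [ b ↔ c ]))
  swap-edge g {h} {b} {c} cc a =
    subst (Edge (Γ P) (cls g)) (sym (cls-≡ (g [ b ↔ c ]) (r [ b′ ↔ c′ ]) (swap-connectedCubic cc a) (Iso-swap g r i b c)))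
      (by-order (ℕₚ.<-cmp (toℕ h′) (toℕ (mate r h′))))
    where
    r = rep (cls g)
    r-ok = rep-ok (cls g)
    open IsCubic (proj₁ r-ok)
    i = rep-iso g cc
    πH = proj₁ (proj₂ i)
    h′ = πH ⟨$⟩ʳ h
    b′ = πH ⟨$⟩ʳ b
    c′ = πH ⟨$⟩ʳ c
    a′ : Adjacent r h′ b′ c′
    a′ = Adjacent-Iso g r i a
    edge : ∀ {h b c} → toℕ h < toℕ (mate r h) → Adjacent r h b c → Edge (Γ P) (cls g) (cls (r [ b ↔ c ]))
    edge {h} {b} {c} h< adj with swap-whitehead (proj₁ r-ok) (Adjacent.nonloop adj) adj
    ... | s , iso = subst (Edge (Γ P) (cls g)) (sym (cls-≡ (r [ b ↔ c ]) (whitehead s r h) (swap-connectedCubic r-ok adj) iso))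
                      (whitehead-edge (cls g) s h<)
    by-order : _ → Edge (Γ P) (cls g) (cls (r [ b′ ↔ c′ ]))
    by-order (tri< h< _ _) = edge h< a′
    by-order (tri≈ _ eq _) = ⊥-elim (mate-nofix h′ (sym (toℕ-injective eq)))
    by-order (tri> _ _ h>) = subst (Edge (Γ P) (cls g))
      (cls-≡ (r [ c′ ↔ b′ ]) (r [ b′ ↔ c′ ]) (swap-connectedCubic r-ok flipped)
        (≗ᵍ⇒Iso {n} _ _ ((λ e → cong (vert r) (τ-comm c′ b′ e)) , λ _ → refl)))
      (edge (subst (toℕ (mate r h′) <_) (cong toℕ (sym (mate-invol h′))) h>) flipped)
      where
      flipped = Adjacent-flip (proj₁ r-ok) a′

  infix 4 _⇝_
  -- Both directions are kept because `Γ P` is directed and the final connection of two classes runs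
  -- its last leg backwards.
  record _⇝_ (g g′ : RawCubic n) : Set where
    constructor reach
    field
      ok   : ConnectedCubic g′
      to   : Star (Edge (Γ P)) (cls g) (cls g′)
      from : Star (Edge (Γ P)) (cls g′) (cls g)
  open _⇝_ public

  ⇝-trans : ∀ {g g′ g″} → g ⇝ g′ → g′ ⇝ g″ → g ⇝ g″
  ⇝-trans r s = reach (ok s) (to r ◅◅ to s) (from s ◅◅ from r)

  Iso⇒⇝ : ∀ g g′ → ConnectedCubic g → Iso g g′ → g ⇝ g′
  Iso⇒⇝ g g′ cc i = reach (Iso-connectedCubic g g′ i cc)
    (subst (Star (Edge (Γ P)) (cls g)) (cls-≡ g g′ cc i) ε) (subst (λ c → Star (Edge (Γ P)) c (cls g)) (cls-≡ g g′ cc i) ε)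

  -- The way back is a swap across the same edge, whose own half-edges have not moved.
  swap-⇝ : ∀ g {h b c} → ConnectedCubic g → Adjacent g h b c → g ⇝ g [ b ↔ c ]
  swap-⇝ g {h} {b} {c} cc a = reach cc′ (swap-edge g cc a ◅ ε)
    (subst (Edge (Γ P) (cls (g [ b ↔ c ]))) (cls-≡ (g [ b ↔ c ] [ c ↔ b ]) g (swap-connectedCubic cc′ back)
      (≗ᵍ⇒Iso {n} _ _ ((λ e → cong (vert g) (trans (cong (τ b c) (τ-comm c b e)) (τ-involutive b c e))) , λ _ → refl)))
      (swap-edge (g [ b ↔ c ]) cc′ back) ◅ ε)
    where
    open Adjacent a
    cc′ = swap-connectedCubic cc a
    h-stays : vert g (τ b c h) ≡ vert g h
    h-stays = cong (vert g) (τ-other b c (λ eq → b≢h (sym eq)) h≢c)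
    h′-stays : vert g (τ b c (mate g h)) ≡ vert g (mate g h)
    h′-stays = cong (vert g) (τ-other b c h′≢b (λ eq → c≢h′ (sym eq)))
    back : Adjacent (g [ b ↔ c ]) h c b
    back = record
      { nonloop = λ eq → nonloop (trans (sym h-stays) (trans eq h′-stays))
      ; b-at = trans (cong (vert g) (τ-right b c)) (trans b-at (sym h-stays))
      ; b≢h = λ eq → h≢c (sym eq)
      ; c-at = trans (cong (vert g) (τ-left b c)) (trans c-at (sym h′-stays))
      ; c≢h′ = λ eq → h′≢b (sym eq) }

  -- `F` is the set of half-edges available to the walk and `p` records where they sit. It is kept
  -- apart from the current vertex map, which changes at every stage of the recursion while the
  -- half-edges in `F` stay put.
  module Slide (m : Fin (6 * n) → Fin (6 * n)) (p : Fin (6 * n) → Fin (2 * n))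
    (F : Fin (6 * n) → Set) (F-mate : ∀ {h} → F h → F (m h)) where

    data Walk : Fin (2 * n) → Fin (2 * n) → Set where
      []   : ∀ {u} → Walk u u
      step : ∀ {w} h → F h → Walk (p (m h)) w → Walk (p h) w

    _++ʷ_ : ∀ {u v w} → Walk u v → Walk v w → Walk u w
    [] ++ʷ w = w
    step h Fh w′ ++ʷ w = step h Fh (w′ ++ʷ w)

    -- The invariant of the recursion. `room` supplies the spare half-edge that trades places with
    -- the one carried over.
    record Placed (v : Fin (6 * n) → Fin (2 * n)) : Set where
      field
        cc     : ConnectedCubic (mkRaw {n} v m)
        fixed  : ∀ {h} → F h → v h ≡ p h
        room   : ∀ {h} → F h → ∃ λ x → v x ≡ p h × ¬ F x

    F≢ : ∀ {f x} → F f → ¬ F x → f ≢ x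
    F≢ Ff ¬Fx refl = ¬Fx Ff

    τ-fixes : ∀ {x k f} → ¬ F x → ¬ F k → F f → τ x k f ≡ f
    τ-fixes ¬Fx ¬Fk Ff = τ-other _ _ (F≢ Ff ¬Fx) (F≢ Ff ¬Fk)

    ¬F-τ : ∀ {x k y} → ¬ F x → ¬ F k → ¬ F y → ¬ F (τ x k y)
    ¬F-τ {x} {k} {y} ¬Fx ¬Fk ¬Fy with τ-view x k y
    ... | left _ eq = subst (¬_ ∘ F) (sym eq) ¬Fk
    ... | right _ eq = subst (¬_ ∘ F) (sym eq) ¬Fx
    ... | other _ _ eq = subst (¬_ ∘ F) (sym eq) ¬Fy

    same-vertex : ∀ {v : Fin (6 * n) → Fin (2 * n)} {x k} → v x ≡ v k → ∀ e → v e ≡ v (τ x k e)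
    same-vertex {v} {x} {k} eq e with τ-view x k e
    ... | left refl τ≡ = trans eq (cong v (sym τ≡))
    ... | right refl τ≡ = trans (sym eq) (cong v (sym τ≡))
    ... | other _ _ τ≡ = cong v (sym τ≡)

    -- A far swap is the conjugate of a nearer one by the swap across the first edge of the walk.
    slide : ∀ {v} → Placed v → ∀ {x k u w} → ¬ F x → ¬ F k → x ≢ k → v x ≡ u → v k ≡ w → Walk u w →
      mkRaw v m ⇝ mkRaw (v ∘ τ x k) m
    slide {v} pl {x} {k} ¬Fx ¬Fk x≢k x-at k-at [] =
      Iso⇒⇝ (mkRaw v m) (mkRaw (v ∘ τ x k) m) (Placed.cc pl) (≗ᵍ⇒Iso {n} _ _ (same-vertex {v} (trans x-at (sym k-at)) , λ _ → refl))
    slide {v} pl {x} {k} {w = w} ¬Fx ¬Fk x≢k x-at k-at (step h Fh walk) with p h ≟ p (m h)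
    ... | yes loop = slide pl ¬Fx ¬Fk x≢k (trans x-at loop) k-at walk
    -- The direct case is split off even if the walk continues: otherwise the spare half-edge `y` at
    -- the second vertex could be `k` itself.
    ... | no nonloop with w ≟ p (m h)
    ...   | yes at = swap-⇝ (mkRaw v m) {h} (Placed.cc pl) (record
              { nonloop = λ eq → nonloop (trans (sym (fixed Fh)) (trans eq (fixed (F-mate Fh))))
              ; b-at = trans x-at (sym (fixed Fh)) ; b≢h = λ eq → F≢ Fh ¬Fx (sym eq)
              ; c-at = trans k-at (trans at (sym (fixed (F-mate Fh)))) ; c≢h′ = λ eq → F≢ (F-mate Fh) ¬Fk (sym eq) })
      where open Placed pl
    ...   | no not-at = ⇝-trans (⇝-trans first middle)
              (⇝-trans last (Iso⇒⇝ (mkRaw (v ∘ τ x y ∘ τ x k ∘ τ y k) m) (mkRaw (v ∘ τ x k) m) (ok last) (≗ᵍ⇒Iso {n} _ _ ((λ e → cong v (conjugate e)) , λ _ → refl))))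
      where
      open Placed pl
      y = proj₁ (room (F-mate Fh))
      y-at = proj₁ (proj₂ (room (F-mate Fh)))
      ¬Fy = proj₂ (proj₂ (room (F-mate Fh)))
      x≢y : x ≢ y
      x≢y eq = nonloop (trans (sym x-at) (trans (cong v eq) y-at))
      k≢y : k ≢ y
      k≢y eq = not-at (trans (sym k-at) (trans (cong v eq) y-at))
      first : mkRaw v m ⇝ mkRaw (v ∘ τ x y) m
      first = swap-⇝ (mkRaw v m) {h} cc (record
        { nonloop = λ eq → nonloop (trans (sym (fixed Fh)) (trans eq (fixed (F-mate Fh))))
        ; b-at = trans x-at (sym (fixed Fh)) ; b≢h = λ eq → F≢ Fh ¬Fx (sym eq)
        ; c-at = trans y-at (sym (fixed (F-mate Fh))) ; c≢h′ = λ eq → F≢ (F-mate Fh) ¬Fy (sym eq) })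
      placed₁ : Placed (v ∘ τ x y)
      placed₁ = record
        { cc = ok first
        ; fixed = λ Ff → trans (cong v (τ-fixes ¬Fx ¬Fy Ff)) (fixed Ff)
        ; room = λ Ff → let z , z-at , ¬Fz = room Ff in
            τ x y z , trans (cong v (τ-involutive x y z)) z-at , ¬F-τ ¬Fx ¬Fy ¬Fz }
      middle : mkRaw (v ∘ τ x y) m ⇝ mkRaw (v ∘ τ x y ∘ τ x k) m
      middle = slide placed₁ ¬Fx ¬Fk x≢k (trans (cong v (τ-left x y)) y-at)
        (trans (cong v (τ-other x y (λ eq → x≢k (sym eq)) k≢y)) k-at) walk
      twice : ∀ {f} → F f → v (τ x y (τ x k f)) ≡ p f
      twice Ff = trans (cong (v ∘ τ x y) (τ-fixes ¬Fx ¬Fk Ff)) (Placed.fixed placed₁ Ff)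
      last : mkRaw (v ∘ τ x y ∘ τ x k) m ⇝ mkRaw (v ∘ τ x y ∘ τ x k ∘ τ y k) m
      last = swap-⇝ (mkRaw (v ∘ τ x y ∘ τ x k) m) {h} (ok middle) (record
        { nonloop = λ eq → nonloop (trans (sym (twice Fh)) (trans eq (twice (F-mate Fh))))
        ; b-at = trans (cong v (trans (cong (τ x y) (τ-other x k (λ eq → x≢y (sym eq)) (λ eq → k≢y (sym eq)))) (τ-right x y)))
                   (trans x-at (sym (twice Fh)))
        ; b≢h = λ eq → F≢ Fh ¬Fy (sym eq)
        ; c-at = trans (cong v (trans (cong (τ x y) (τ-right x k)) (τ-left x y))) (trans y-at (sym (twice (F-mate Fh))))
        ; c≢h′ = λ eq → F≢ (F-mate Fh) ¬Fk (sym eq) })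
      conjugate : ∀ e → τ x y (τ x k (τ y k e)) ≡ τ x k e
      conjugate e = begin
        τ x y (τ x k (τ y k e))                         ≡⟨ cong (τ x y) (τ-natural (τ x k) (τ-injective x k) y k e) ⟩
        τ x y (τ (τ x k y) (τ x k k) (τ x k e))         ≡⟨ cong₂ (λ a b → τ x y (τ a b (τ x k e)))
                                                            (τ-other x k (λ eq → x≢y (sym eq)) (λ eq → k≢y (sym eq))) (τ-right x k) ⟩
        τ x y (τ y x (τ x k e))                         ≡⟨ cong (τ x y) (τ-comm y x _) ⟩
        τ x y (τ x y (τ x k e))                         ≡⟨ τ-involutive x y _ ⟩
        τ x k e                                         ∎
        where open ≡-Reasoning

-- Spanning paths and connectedness

-- A path with `j` edges: slot 0 of a vertex leads back, slot 2 leads forward and slot 1 is spare.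
-- The mate map enters only through `Links`, so one layout can serve two graphs with the same vertex
-- map.
record Layout {n : ℕ} (v : Fin (6 * n) → Fin (2 * n)) (j : ℕ) : Set where
  field
    σ        : Fin (suc j) → Fin (2 * n)
    slot     : Fin (suc j) → Fin 3 → Fin (6 * n)
    σ-inj    : ∀ {i i′} → σ i ≡ σ i′ → i ≡ i′
    slot-inj : ∀ {i s s′} → slot i s ≡ slot i s′ → s ≡ s′
    slot-at  : ∀ i s → v (slot i s) ≡ σ i

  slot-injective : ∀ {i i′ s s′} → slot i s ≡ slot i′ s′ → i ≡ i′ × s ≡ s′
  slot-injective {i} {i′} {s} {s′} eq with σ-inj {i} {i′} (trans (sym (slot-at i s)) (trans (cong v eq) (slot-at i′ s′)))
  ... | refl = refl , slot-inj {i} eq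

  OnPath : Fin (6 * n) → Set
  OnPath h = (∃ λ (i : Fin j) → h ≡ slot (inject₁ i) 2F) ⊎ (∃ λ (i : Fin j) → h ≡ slot (suc i) 0F)

  Links : (Fin (6 * n) → Fin (6 * n)) → Set
  Links m = ∀ (i : Fin j) → m (slot (inject₁ i) 2F) ≡ slot (suc i) 0F

  OnPath-at : ∀ {h} → OnPath h → ∃ λ i → v h ≡ σ i
  OnPath-at (inj₁ (i , refl)) = _ , slot-at _ _
  OnPath-at (inj₂ (i , refl)) = _ , slot-at _ _

  slot-1-free : ∀ i → ¬ OnPath (slot i 1F)
  slot-1-free i (inj₁ (_ , eq)) with () ← proj₂ (slot-injective eq)
  slot-1-free i (inj₂ (_ , eq)) with () ← proj₂ (slot-injective eq)

  slot-00-free : ¬ OnPath (slot zero 0F)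
  slot-00-free (inj₁ (_ , eq)) with () ← proj₂ (slot-injective eq)
  slot-00-free (inj₂ (_ , eq)) with () ← proj₁ (slot-injective eq)

  relabel : ∀ x k → Layout {n} (v ∘ τ x k) j
  relabel x k = record
    { σ = σ ; slot = λ i s → τ x k (slot i s) ; σ-inj = σ-inj
    ; slot-inj = λ {i} eq → slot-inj {i} (τ-injective x k eq)
    ; slot-at = λ i s → trans (cong v (τ-involutive x k _)) (slot-at i s) }

module Track {n : ℕ} (P : ClassPresentation n) {v : Fin (6 * n) → Fin (2 * n)} {j : ℕ} (L : Layout {n} v j)
  {m : Fin (6 * n) → Fin (6 * n)} (cc : ConnectedCubic (mkRaw {n} v m)) (link : Layout.Links L m) where

  open Layout L
  open Reach P
  open IsCubic (proj₁ cc)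

  link⁻ : ∀ i → m (slot (suc i) 0F) ≡ slot (inject₁ i) 2F
  link⁻ i = trans (cong m (sym (link i))) (mate-invol _)

  OnPath-mate : ∀ {h} → OnPath h → OnPath (m h)
  OnPath-mate (inj₁ (i , refl)) = inj₂ (i , link i)
  OnPath-mate (inj₂ (i , refl)) = inj₁ (i , link⁻ i)

  open Slide m v OnPath OnPath-mate

  walk-step : ∀ {h u u′} → OnPath h → v h ≡ u → v (m h) ≡ u′ → Walk u u′
  walk-step on refl refl = step _ on []

  walk-from-zero : ∀ i → Walk (σ zero) (σ i)
  walk-from-zero = <-weakInduction _ [] λ i w → w ++ʷ walk-step (inj₁ (i , refl)) (slot-at _ _)
    (trans (cong v (link i)) (slot-at _ _))

  walk-to-zero : ∀ i → Walk (σ i) (σ zero)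
  walk-to-zero = <-weakInduction _ [] λ i w → walk-step (inj₂ (i , refl)) (slot-at _ _)
    (trans (cong v (link⁻ i)) (slot-at _ _)) ++ʷ w

  room : ∀ {h} → OnPath h → ∃ λ x → v x ≡ v h × ¬ OnPath x
  room on = let i , at = OnPath-at on in slot i 1F , trans (slot-at i 1F) (sym at) , slot-1-free i

  -- Slot 1 is the spare half-edge at every vertex of the path. The walk goes through the first
  -- vertex of the path, which avoids comparing `i` with `i′`.
  swap-free : ∀ {x k i i′} → ¬ OnPath x → ¬ OnPath k → v x ≡ σ i → v k ≡ σ i′ →
    mkRaw v m ⇝ mkRaw (v ∘ τ x k) m
  swap-free {x} {k} {i} {i′} ¬x ¬k x-at k-at with x ≟ k
  ... | no x≢k = slide (record { cc = cc ; fixed = λ _ → refl ; room = room }) ¬x ¬k x≢k x-at k-at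
                   (walk-to-zero i ++ʷ walk-from-zero i′)
  ... | yes x≡k = Iso⇒⇝ (mkRaw v m) (mkRaw (v ∘ τ x k) m) cc
                   (≗ᵍ⇒Iso {n} _ _ (same-vertex {v} (cong v x≡k) , λ _ → refl))

  relabel-links : ∀ {x k} → ¬ OnPath x → ¬ OnPath k → Layout.Links {n} (relabel x k) m
  relabel-links {x} {k} ¬x ¬k i = trans (cong m (τ-fixes ¬x ¬k (inj₁ (i , refl))))
    (trans (link i) (sym (τ-fixes ¬x ¬k (inj₂ (i , refl)))))

module Connect {n : ℕ} (P : ClassPresentation n) where
  open Reach P

  record PathIn (g : RawCubic n) (j : ℕ) : Set where
    field
      layout : Layout {n} (vert g) j
      links  : Layout.Links layout (mate g)

  leaving : ∀ {g : RawCubic n} {S : Fin (2 * n) → Set} → (∀ v → Dec (S v)) → ∀ {u w} → Star (Adj g) u w →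
    S u → ¬ S w → ∃ λ h → S (vert g h) × ¬ S (vert g (mate g h))
  leaving S? ε Su ¬Sw = ⊥-elim (¬Sw Su)
  leaving {g} S? (_◅_ {j = z} (h , refl , refl) walk) Su ¬Sw with S? z
  ... | yes Sz = leaving {g} S? walk Sz ¬Sw
  ... | no ¬Sz = h , Su , ¬Sz

  start : ∀ {g} → ConnectedCubic g → Fin (6 * n) → PathIn g 0
  start {g} cc h with othersAt-pair (proj₁ cc) h
  ... | a , b , _ , o = record { layout = record
    { σ = λ _ → vert g h ; slot = λ _ → slot ; σ-inj = λ { {0F} {0F} _ → refl } ; slot-inj = inj
    ; slot-at = λ { _ 0F → O.a-at ; _ 1F → O.b-at ; _ 2F → refl } } ; links = λ () }
    where
    module O = Others o
    slot : Fin 3 → Fin (6 * n)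
    slot 0F = a
    slot 1F = b
    slot 2F = h
    inj : ∀ {s s′} → slot s ≡ slot s′ → s ≡ s′
    inj {0F} {0F} _ = refl
    inj {0F} {1F} eq = ⊥-elim (O.a≢b eq)
    inj {0F} {2F} eq = ⊥-elim (O.a≢h eq)
    inj {1F} {0F} eq = ⊥-elim (O.a≢b (sym eq))
    inj {1F} {1F} _ = refl
    inj {1F} {2F} eq = ⊥-elim (O.b≢h eq)
    inj {2F} {0F} eq = ⊥-elim (O.a≢h (sym eq))
    inj {2F} {1F} eq = ⊥-elim (O.b≢h (sym eq))
    inj {2F} {2F} _ = refl

  prepend : ∀ {g j} → ConnectedCubic g → (p : PathIn g j) →
    (∀ i → Layout.σ (PathIn.layout p) i ≢ vert g (mate g (Layout.slot (PathIn.layout p) zero 0F))) → PathIn g (suc j)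
  prepend {g} {j} cc p fresh = record
    { layout = record { σ = σ′ ; slot = slot′ ; σ-inj = σ′-inj ; slot-inj = λ {i} → slot′-inj {i} ; slot-at = slot′-at }
    ; links = links′ }
    where
    open Layout (PathIn.layout p)
    open IsCubic (proj₁ cc)
    -- `start` puts its half-edge into slot 2, so the new head is already linked to slot 0 of the
    -- old one.
    module L₀ = Layout (PathIn.layout (start cc (mate g (slot zero 0F))))
    σ′ : Fin (suc (suc j)) → Fin (2 * n)
    σ′ zero = L₀.σ zero
    σ′ (suc i) = σ i
    slot′ : Fin (suc (suc j)) → Fin 3 → Fin (6 * n)
    slot′ zero = L₀.slot zero
    slot′ (suc i) = slot i
    σ′-inj : ∀ {i i′} → σ′ i ≡ σ′ i′ → i ≡ i′
    σ′-inj {zero} {zero} _ = refl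
    σ′-inj {zero} {suc i} eq = ⊥-elim (fresh i (sym eq))
    σ′-inj {suc i} {zero} eq = ⊥-elim (fresh i eq)
    σ′-inj {suc i} {suc i′} eq = cong suc (σ-inj eq)
    slot′-inj : ∀ {i s s′} → slot′ i s ≡ slot′ i s′ → s ≡ s′
    slot′-inj {zero} eq = L₀.slot-inj {zero} eq
    slot′-inj {suc i} eq = slot-inj {i} eq
    slot′-at : ∀ i s → vert g (slot′ i s) ≡ σ′ i
    slot′-at zero = L₀.slot-at zero
    slot′-at (suc i) = slot-at i
    links′ : ∀ (i : Fin (suc j)) → mate g (slot′ (inject₁ i) 2F) ≡ slot′ (suc i) 0F
    links′ zero = mate-invol _
    links′ (suc i) = PathIn.links p i

  -- Any half-edge leaving the path can be carried to the head of the path: the swap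
  -- along the path keeps the path itself, hence the connectedness.
  grow : ∀ {g j} → ConnectedCubic g → PathIn g j → suc j < 2 * n → ∃ λ g′ → g ⇝ g′ × PathIn g′ (suc j)
  grow {g} {j} cc p j< with any? (λ v → ¬? (any? (λ i → σ i ≟ v)))
    where open Layout (PathIn.layout p)
  ... | no covers = ⊥-elim (ℕₚ.<⇒≱ j< (injective⇒≤ {f = index} index-inj))
    where
    open Layout (PathIn.layout p)
    covered : ∀ v → ∃ λ i → σ i ≡ v
    covered v = decidable-stable (any? (λ i → σ i ≟ v)) (λ missed → covers (v , missed))
    index : Fin (2 * n) → Fin (suc j)
    index v = proj₁ (covered v)
    index-inj : ∀ {u v} → index u ≡ index v → u ≡ v
    index-inj {u} {v} eq = trans (sym (proj₂ (covered u))) (trans (cong σ eq) (proj₂ (covered v)))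
  ... | yes (w , w∉) with leaving {g} (λ v → any? (λ i → σ i ≟ v)) (proj₂ cc (σ zero) w) (zero , refl) w∉
    where open Layout (PathIn.layout p)
  ...   | k , (i , k-at) , k′∉ = g′ , moved , prepend (ok moved) path′ fresh
    where
    open Layout (PathIn.layout p)
    open Track P (PathIn.layout p) cc (PathIn.links p)
    open IsCubic (proj₁ cc)
    x = slot zero 0F
    k-free : ¬ OnPath k
    k-free on = let i , at = OnPath-at (OnPath-mate on) in k′∉ (i , sym at)
    g′ = g [ x ↔ k ]
    moved : g ⇝ g′
    moved = swap-free slot-00-free k-free (slot-at zero 0F) (sym k-at)
    path′ : PathIn g′ j
    path′ = record { layout = relabel x k ; links = relabel-links {x} {k} slot-00-free k-free }
    -- In the relabelled layout slot 0 of the head is `k`; its mate is not moved by the swap and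
    -- still sits off the path.
    fresh : ∀ i → σ i ≢ vert g (τ x k (mate g (τ x k x)))
    fresh i eq = k′∉ (i , trans eq (cong (vert g) (trans (cong (τ x k ∘ mate g) (τ-left x k))
      (τ-other x k (λ eq → k′∉ (zero , sym (trans (cong (vert g) eq) (slot-at zero 0F)))) (mate-nofix k)))))

  spanning-path : ∀ {g} → ConnectedCubic g → Fin (6 * n) → ∀ j → suc j ≤ 2 * n → ∃ λ g′ → g ⇝ g′ × PathIn g′ j
  spanning-path cc h zero _ = _ , reach cc ε ε , start cc h
  spanning-path cc h (suc j) j< with spanning-path cc h j (ℕₚ.<⇒≤ j<)
  ... | g₁ , r₁ , p₁ with grow (ok r₁) p₁ j<
  ... | g₂ , r₂ , p₂ = g₂ , ⇝-trans r₁ r₂ , p₂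

  module Rematch {v : Fin (6 * n) → Fin (2 * n)} {j : ℕ} (L : Layout {n} v j) (full : 2 * n ≤ suc j)
    {m′ : Fin (6 * n) → Fin (6 * n)} (cc′ : ConnectedCubic (mkRaw {n} v m′)) (link′ : Layout.Links L m′) where
    open Layout L

    located : ∀ h → ∃ λ i → v h ≡ σ i
    located h = let i , eq = injective⇒surjective full σ σ-inj (v h) in i , sym eq

    differ? : ∀ (m : Fin (6 * n) → Fin (6 * n)) h → Dec (m h ≢ m′ h)
    differ? m h = ¬? (m h ≟ m′ h)

    -- Exchanging the vertices of `a` and `b` amounts, after renaming the two half-edges, to
    -- exchanging their partners, which gives `l` its target partner `b`. The path spans, so both
    -- half-edges lie at its vertices, and both are off the path because `m` and `m′` agree on it.
    -- The number of wrong partners decreases.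
    rematch : ∀ {m} → ConnectedCubic (mkRaw {n} v m) → Links m → Acc _<_ (count (differ? m)) →
      mkRaw v m ⇝ mkRaw v m′
    rematch {m} cc link (acc rec) with any? (differ? m)
    ... | no same = Iso⇒⇝ (mkRaw v m) (mkRaw v m′) cc
          (≗ᵍ⇒Iso {n} _ _ ((λ _ → refl) , λ h → decidable-stable (m h ≟ m′ h) (λ ne → same (h , ne))))
    ... | yes (l , a≢b) = ⇝-trans swapped
          (⇝-trans (Iso⇒⇝ (mkRaw (v ∘ τ a b) m) (mkRaw v m₁) (ok swapped) iso)
            (rematch (Iso-connectedCubic (mkRaw (v ∘ τ a b) m) (mkRaw v m₁) iso (ok swapped)) link₁ (rec fewer)))
      where
      open Track P L cc link
      module C = IsCubic (proj₁ cc)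
      module C′ = IsCubic (proj₁ cc′)
      module T′ = Track P L cc′ link′
      a = m l
      b = m′ l
      agree : ∀ {h} → OnPath h → m h ≡ m′ h
      agree (inj₁ (i , refl)) = trans (link i) (sym (link′ i))
      agree (inj₂ (i , refl)) = trans (link⁻ i) (sym (T′.link⁻ i))
      a-differs : m a ≢ m′ a
      a-differs eq = a≢b (trans (sym (C′.mate-invol a)) (cong m′ (trans (sym eq) (C.mate-invol l))))
      b-differs : m b ≢ m′ b
      b-differs eq = a≢b (sym (trans (sym (C.mate-invol b)) (cong m (trans eq (C′.mate-invol l)))))
      a-free : ¬ OnPath a
      a-free on = a-differs (agree on)
      b-free : ¬ OnPath b
      b-free on = b-differs (agree on)
      swapped : mkRaw v m ⇝ mkRaw (v ∘ τ a b) m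
      swapped = swap-free a-free b-free (proj₂ (located a)) (proj₂ (located b))
      m₁ : Fin (6 * n) → Fin (6 * n)
      m₁ = τ a b ∘ m ∘ τ a b
      iso : Iso {n} (mkRaw (v ∘ τ a b) m) (mkRaw v m₁)
      iso = id-perm , τ-perm a b , (λ _ → refl) , λ h → cong (τ a b ∘ m) (τ-involutive a b h)
      path-fixed : ∀ {h} → OnPath h → τ a b h ≡ h
      path-fixed on = τ-other a b (λ { refl → a-free on }) (λ { refl → b-free on })
      link₁ : Links m₁
      link₁ i = trans (cong (τ a b ∘ m) (path-fixed (inj₁ (i , refl))))
        (trans (cong (τ a b) (link i)) (path-fixed (inj₂ (i , refl))))
      -- A half-edge with the right partner is untouched: neither it nor its partner is `a` or `b`,
      -- since `a`, `b` and `l` all have wrong partners.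
      still-agree : ∀ h → m h ≡ m′ h → m₁ h ≡ m′ h
      still-agree h eq = trans (cong (τ a b ∘ m) (τ-other a b (λ { refl → a-differs eq }) (λ { refl → b-differs eq })))
        (trans (τ-other a b
          (λ mh≡a → a≢b (subst (λ z → m z ≡ m′ z) (trans (sym (C.mate-invol h)) (trans (cong m mh≡a) (C.mate-invol l))) eq))
          (λ mh≡b → a≢b (subst (λ z → m z ≡ m′ z)
            (trans (sym (C′.mate-invol h)) (trans (cong m′ (trans (sym eq) mh≡b)) (C′.mate-invol l))) eq))) eq)
      l-agrees : m₁ l ≡ m′ l
      l-agrees = trans (cong (τ a b ∘ m) (τ-other a b (λ eq → C.mate-nofix l (sym eq)) (λ eq → C′.mate-nofix l (sym eq))))
        (τ-left a b)
      fewer : count (differ? m₁) < count (differ? m)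
      fewer = count-< (differ? m₁) (differ? m) (λ h ne eq → ne (still-agree h eq)) l a≢b (λ ne → ne l-agrees)

  -- The slots of a spanning path exhaust the half-edges, so matching slots of the two paths gives
  -- bijections of vertices and half-edges. Transported by them, `g′` becomes `g″`, with the vertex
  -- map and the path of `g`; only the mates may still differ.
  align : ∀ {g g′ j} → ConnectedCubic g → ConnectedCubic g′ → 2 * n ≤ suc j → 6 * n ≤ suc j * 3 →
    PathIn g j → PathIn g′ j → g ⇝ g′
  align {g} {g′} {j} cc cc′ full full₃ p p′ = ⇝-trans
    (rematch cc (PathIn.links p) (<-wellFounded _))
    (Iso⇒⇝ g″ g′ cc″ (Iso-sym g′ g″ iso))
    where
    module L = Layout (PathIn.layout p)
    module L′ = Layout (PathIn.layout p′)
    labelling : ∀ {v} → Layout {n} v j → Fin (suc j * 3) → Fin (6 * n)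
    labelling l e = let i , s = remQuot 3 e in Layout.slot l i s
    labelling-inj : ∀ {v} (l : Layout {n} v j) {e e′} → labelling l e ≡ labelling l e′ → e ≡ e′
    labelling-inj l {e} {e′} eq with Layout.slot-injective l eq
    ... | i≡ , s≡ = trans (sym (combine-remQuot {suc j} 3 e)) (trans (cong₂ combine i≡ s≡) (combine-remQuot {suc j} 3 e′))
    bijection : ∀ {a b} → b ≤ a → (f f′ : Fin a → Fin b) → (∀ {i k} → f i ≡ f k → i ≡ k) → (∀ {i k} → f′ i ≡ f′ k → i ≡ k) →
      Σ (Permutation′ b) λ π → ∀ i → π ⟨$⟩ʳ (f i) ≡ f′ i
    bijection {a} {b} le f f′ inj inj′ = permutation (carry f f′ inj) (carry f′ f inj′) (inverse f′ f inj′ inj) (inverse f f′ inj inj′)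
      , computes f f′ inj
      where
      carry : (f f′ : Fin a → Fin b) → (∀ {i k} → f i ≡ f k → i ≡ k) → Fin b → Fin b
      carry f f′ inj y = f′ (proj₁ (injective⇒surjective le f inj y))
      computes : (f f′ : Fin a → Fin b) (inj : ∀ {i k} → f i ≡ f k → i ≡ k) → ∀ i → carry f f′ inj (f i) ≡ f′ i
      computes f f′ inj i = cong f′ (inj (proj₂ (injective⇒surjective le f inj (f i))))
      inverse : (f f′ : Fin a → Fin b) (inj : ∀ {i k} → f i ≡ f k → i ≡ k) (inj′ : ∀ {i k} → f′ i ≡ f′ k → i ≡ k) →
        ∀ y → carry f′ f inj′ (carry f f′ inj y) ≡ y
      inverse f f′ inj inj′ y = trans (computes f′ f inj′ _) (proj₂ (injective⇒surjective le f inj y))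
    onV = bijection full L′.σ L.σ L′.σ-inj L.σ-inj
    onH = bijection full₃ (labelling (PathIn.layout p′)) (labelling (PathIn.layout p))
            (labelling-inj (PathIn.layout p′)) (labelling-inj (PathIn.layout p))
    πV = proj₁ onV
    πH = proj₁ onH
    slot-to-slot : ∀ i s → πH ⟨$⟩ʳ L′.slot i s ≡ L.slot i s
    slot-to-slot i s = trans (cong (λ q → πH ⟨$⟩ʳ L′.slot (proj₁ q) (proj₂ q)) (sym (remQuot-combine i s)))
      (trans (proj₂ onH (combine i s)) (cong (λ q → L.slot (proj₁ q) (proj₂ q)) (remQuot-combine i s)))
    g″ : RawCubic n
    g″ = mkRaw (vert g) (λ h → πH ⟨$⟩ʳ mate g′ (πH ⟨$⟩ˡ h))
    iso : Iso g′ g″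
    iso = πV , πH , vert-ok , λ h → cong (λ e → πH ⟨$⟩ʳ mate g′ e) (inverseˡ πH)
      where
      vert-ok : ∀ h → vert g (πH ⟨$⟩ʳ h) ≡ πV ⟨$⟩ʳ vert g′ h
      vert-ok h = let e , eq = injective⇒surjective full₃ (labelling (PathIn.layout p′)) (labelling-inj (PathIn.layout p′)) h
        in subst (λ h → vert g (πH ⟨$⟩ʳ h) ≡ πV ⟨$⟩ʳ vert g′ h) eq (at-label e)
        where
        at-label : ∀ e → let h = labelling (PathIn.layout p′) e in vert g (πH ⟨$⟩ʳ h) ≡ πV ⟨$⟩ʳ vert g′ h
        at-label e = let i , s = remQuot {suc j} 3 e in trans (cong (vert g) (proj₂ onH e))
          (trans (L.slot-at i s) (sym (trans (cong (πV ⟨$⟩ʳ_) (L′.slot-at i s)) (proj₂ onV i))))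
    cc″ : ConnectedCubic g″
    cc″ = Iso-connectedCubic g′ g″ iso cc′
    links″ : L.Links (mate g″)
    links″ i = trans (cong (λ h → πH ⟨$⟩ʳ mate g′ h) (trans (cong (πH ⟨$⟩ˡ_) (sym (slot-to-slot _ _))) (inverseˡ πH)))
      (trans (cong (πH ⟨$⟩ʳ_) (PathIn.links p′ i)) (slot-to-slot _ _))
    open Rematch (PathIn.layout p) full cc″ links″

Γ-connected : ∀ {n} (P : ClassPresentation n) → 1 ≤ n → DiConnected (Γ P)
Γ-connected {suc n′} P _ x y with spanning-path (rep-ok x) zero _ ℕₚ.≤-refl | spanning-path (rep-ok y) zero _ ℕₚ.≤-refl
  where
  open ClassPresentation P
  open Connect P
... | g₁ , r₁ , p₁ | g₂ , r₂ , p₂ = subst₂ (Star (Edge (Γ P))) (cls-rep x) (cls-rep y)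
      (to r₁ ◅◅ to (align (ok r₁) (ok r₂) ℕₚ.≤-refl (ℕₚ.≤-reflexive six) p₁ p₂) ◅◅ from r₂)
  where
  open ClassPresentation P
  open Connect P
  open Reach P
  six : 6 * suc n′ ≡ 2 * suc n′ * 3
  six = trans (ℕₚ.*-assoc 3 2 (suc n′)) (ℕₚ.*-comm 3 (2 * suc n′))

-- Balanced bridges and tripods

-- The two half-edges that trade places sit at the two ends of the edge, hence at vertices of one
-- colour.
whitehead-colour : {A : Set} {g : RawCubic n} → IsCubic g → (c : Fin (2 * n) → A) → ∀ s h →
  c (vert g h) ≡ c (vert g (mate g h)) →
  (∀ e → c (vert (whitehead s g h) e) ≡ c (vert g e)) × (∀ e → mate (whitehead s g h) e ≡ mate g e)
whitehead-colour {n} {g = g} cubic c s h mono = cases (vert g h ≟ vert g (mate g h))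
  where
  SameColours : RawCubic n → Set
  SameColours g′ = (∀ e → c (vert g′ e) ≡ c (vert g e)) × (∀ e → mate g′ e ≡ mate g e)
  cases : Dec (vert g h ≡ vert g (mate g h)) → SameColours (whitehead s g h)
  cases (yes loop) = subst SameColours (sym (whitehead-loop cubic s h loop)) ((λ _ → refl) , λ _ → refl)
  cases (no nonloop) with whitehead-swaps cubic h nonloop
  ... | a , b , c₁ , d , o₁ , o₂ , moved = (λ e → trans (cong c (proj₁ (moved s) e)) (swap-colour (y-at s) e)) , proj₂ (moved s)
    where
    y-at : ∀ s → vert g (if s then d else c₁) ≡ vert g (mate g h)
    y-at false = Others.a-at o₂
    y-at true = Others.b-at o₂
    swap-colour : ∀ {y} → vert g y ≡ vert g (mate g h) → ∀ e → c (vert g (τ b y e)) ≡ c (vert g e)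
    swap-colour {y} at e with τ-view b y e
    ... | left refl eq = trans (cong (c ∘ vert g) eq) (trans (cong c at) (trans (sym mono) (cong c (sym (Others.b-at o₁)))))
    ... | right refl eq = trans (cong (c ∘ vert g) eq) (trans (cong c (Others.b-at o₁)) (trans mono (cong c (sym at))))
    ... | other _ _ eq = cong (c ∘ vert g) eq

-- The bound 6 comes from tripods: three half-edges at the centre and their mates. Both halves of an
-- edge are listed because `edgeReps` may keep either, so the later 12 = 6 · 2 can count an edge
-- twice.
record Robust (Q : RawCubic n → Set) : Set where
  field
    invariant : ∀ g g′ → Iso g g′ → Q g → Q g′
    stable    : ∀ g → ConnectedCubic g → Q g →
      Σ (List (Fin (6 * n))) λ hs → length hs ≤ 6 × (∀ s h → h ∉ hs → Q (whitehead s g h))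

Crosses : {A : Set} (g : RawCubic n) → (Fin (2 * n) → A) → Fin (6 * n) → Set
Crosses g c h = c (vert g h) ≢ c (vert g (mate g h))

-- `bridge` allows each side at most one crossing half-edge, hence at most one crossing edge. The
-- injective `sample` says that each side has at least `b` vertices.
record Split (b : ℕ) (g : RawCubic n) : Set where
  field
    side     : Fin (2 * n) → Bool
    bridge   : ∀ h h′ → Crosses g side h → Crosses g side h′ → side (vert g h) ≡ side (vert g h′) → h ≡ h′
    sample   : Bool → Fin b → Fin (2 * n)
    sample-inj : ∀ s {i j} → sample s i ≡ sample s j → i ≡ j
    sample-in  : ∀ s i → side (sample s i) ≡ s

-- Colour 0 marks the centre; the other three colours are the branches at it.
record Tripod (b : ℕ) (g : RawCubic n) : Set where
  field
    centre   : Fin (2 * n)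
    colour   : Fin (2 * n) → Fin 4
    colour-0 : ∀ v → colour v ≡ 0F → v ≡ centre
    branch   : ∀ h → colour (vert g h) ≢ 0F → colour (vert g (mate g h)) ≢ 0F →
      colour (vert g h) ≡ colour (vert g (mate g h))
    code     : Fin (2 * n) → Fin b
    code-inj : ∀ u v → colour u ≡ colour v → code u ≡ code v → u ≡ v

-- Take the side `s` without the centre. A walk from a vertex of it to the centre keeps its branch
-- colour until it leaves the side, and it leaves by the only crossing half-edge. So the whole side
-- has one colour, and `code` squeezes too many samples into `Fin b`.
Split-Tripod-disjoint : ∀ {a b} {g : RawCubic n} → ConnectedCubic g → b < a → Split a g → Tripod b g → ⊥
Split-Tripod-disjoint {a = zero} _ () _ _
Split-Tripod-disjoint {n} {suc a} {b} {g} (cubic , conn) b<a sp tr =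
  ℕₚ.<⇒≱ b<a (injective⇒≤ {f = code ∘ sample s} λ {i} {j} eq →
    sample-inj s (code-inj _ _ (trans (one-colour i) (sym (one-colour j))) eq))
  where
  open Split sp
  open Tripod tr
  open IsCubic cubic
  s = not (side centre)
  far : ∀ {v} → side v ≡ s → colour v ≢ 0F
  far eq c≡0 with refl ← colour-0 _ c≡0 = Boolₚ.not-¬ (sym eq) refl
  exit : ∀ {v} → Star (Adj g) v centre → side v ≡ s →
    ∃ λ h → side (vert g h) ≡ s × colour (vert g h) ≡ colour v × Crosses g side h
  exit ε eq = ⊥-elim (Boolₚ.not-¬ (sym eq) refl)
  exit (_◅_ {j = z} (h , refl , refl) walk) eq with side z Boolₚ.≟ s
  ... | no out = h , eq , refl , λ same → out (trans (sym same) eq)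
  ... | yes in′ with exit walk in′
  ...   | h′ , h′-in , h′-colour , crosses = h′ , h′-in , trans h′-colour (sym (branch h (far eq) (far in′))) , crosses
  one-colour : ∀ i → colour (sample s i) ≡ colour (sample s zero)
  one-colour i with exit (conn (sample s i) centre) (sample-in s i) | exit (conn (sample s zero) centre) (sample-in s zero)
  ... | h , in₁ , c₁ , x₁ | h′ , in₂ , c₂ , x₂ =
    trans (sym c₁) (trans (cong (colour ∘ vert g) (bridge h h′ x₁ x₂ (trans in₁ (sym in₂)))) c₂)

module Back (g g′ : RawCubic n) (i : Iso g g′) where
  private
    πV = proj₁ i
    πH = proj₁ (proj₂ i)
    v≡ = proj₁ (proj₂ (proj₂ i))
    m≡ = proj₂ (proj₂ (proj₂ i))

  vert-back : ∀ h → πV ⟨$⟩ˡ vert g′ h ≡ vert g (πH ⟨$⟩ˡ h)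
  vert-back h = trans (cong (λ e → πV ⟨$⟩ˡ vert g′ e) (sym (inverseʳ πH)))
    (trans (cong (πV ⟨$⟩ˡ_) (v≡ _)) (inverseˡ πV))

  mate-back : ∀ h → πH ⟨$⟩ˡ mate g′ h ≡ mate g (πH ⟨$⟩ˡ h)
  mate-back h = trans (cong (λ e → πH ⟨$⟩ˡ mate g′ e) (sym (inverseʳ πH)))
    (trans (cong (πH ⟨$⟩ˡ_) (m≡ _)) (inverseˡ πH))

  vert-mate-back : ∀ h → πV ⟨$⟩ˡ vert g′ (mate g′ h) ≡ vert g (mate g (πH ⟨$⟩ˡ h))
  vert-mate-back h = trans (vert-back _) (cong (vert g) (mate-back h))

-- Half-edge colours along g determine both properties, so a move across a monochromatic edge keeps them.
module _ {b : ℕ} {g g′ : RawCubic n} where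

  Split-transport : (sp : Split b g) →
    (∀ e → Split.side sp (vert g′ e) ≡ Split.side sp (vert g e)) → (∀ e → mate g′ e ≡ mate g e) → Split b g′
  Split-transport sp c≡ m≡ = record
    { side = side
    ; bridge = λ h h′ x x′ eq → bridge h h′ (crosses h x) (crosses h′ x′) (trans (sym (c≡ h)) (trans eq (c≡ h′)))
    ; sample = sample ; sample-inj = sample-inj ; sample-in = sample-in }
    where
    open Split sp
    crosses : ∀ h → Crosses g′ side h → Crosses g side h
    crosses h x eq = x (trans (c≡ h) (trans eq (trans (cong (side ∘ vert g) (sym (m≡ h))) (sym (c≡ _)))))

  Tripod-transport : (tr : Tripod b g) →
    (∀ e → Tripod.colour tr (vert g′ e) ≡ Tripod.colour tr (vert g e)) → (∀ e → mate g′ e ≡ mate g e) → Tripod b g′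
  Tripod-transport tr c≡ m≡ = record
    { centre = centre ; colour = colour ; colour-0 = colour-0
    ; branch = λ h ne ne′ → trans (c≡ h) (trans (branch h (ne ∘ trans (c≡ h)) (ne′ ∘ trans (end h))) (sym (end h)))
    ; code = code ; code-inj = code-inj }
    where
    open Tripod tr
    end : ∀ h → colour (vert g′ (mate g′ h)) ≡ colour (vert g (mate g h))
    end h = trans (c≡ _) (cong (colour ∘ vert g) (m≡ h))

Split-robust : ∀ {b} → Robust {n} (Split b)
Split-robust {n} {b} = record { invariant = inv ; stable = stb }
  where
  inv : ∀ g g′ → Iso g g′ → Split b g → Split b g′
  inv g g′ i sp = record
    { side = side ∘ (πV ⟨$⟩ˡ_)
    ; bridge = λ h h′ x x′ eq → perm-injective (Data.Fin.Permutation.flip πH)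
        (bridge _ _ (crosses h x) (crosses h′ x′)
          (trans (cong side (sym (vert-back h))) (trans eq (cong side (vert-back h′)))))
    ; sample = λ s j → πV ⟨$⟩ʳ sample s j
    ; sample-inj = λ s eq → sample-inj s (perm-injective πV eq)
    ; sample-in = λ s j → trans (cong side (inverseˡ πV)) (sample-in s j) }
    where
    open Split sp
    open Back g g′ i
    πV = proj₁ i
    πH = proj₁ (proj₂ i)
    crosses : ∀ h → Crosses g′ (side ∘ (πV ⟨$⟩ˡ_)) h → Crosses g side (πH ⟨$⟩ˡ h)
    crosses h x eq = x (trans (cong side (vert-back h)) (trans eq (cong side (sym (vert-mate-back h)))))
  stb : ∀ g → ConnectedCubic g → Split b g →
    Σ (List (Fin (6 * n))) λ hs → length hs ≤ 6 × (∀ s h → h ∉ hs → Split b (whitehead s g h))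
  stb g (cubic , _) sp with any? (λ h → ¬? (side (vert g h) Boolₚ.≟ side (vert g (mate g h))))
    where open Split sp
  ... | no none = [] , z≤n , λ s h _ → uncurry (Split-transport sp) (whitehead-colour cubic side s h
          (decidable-stable (side (vert g h) Boolₚ.≟ _) (λ x → none (h , x))))
    where open Split sp
  ... | yes (h₀ , x₀) = h₀ ∷ mate g h₀ ∷ [] , s≤s (s≤s z≤n) , λ s h h∉ → uncurry (Split-transport sp) (whitehead-colour cubic side s h
          (decidable-stable (side (vert g h) Boolₚ.≟ _) (λ x → h∉ (listed h x))))
    where
    open Split sp
    open IsCubic cubic
    listed : ∀ h → Crosses g side h → h ∈ h₀ ∷ mate g h₀ ∷ []
    listed h x with side (vert g h) Boolₚ.≟ side (vert g h₀)
    ... | yes eq = here (bridge h h₀ x x₀ eq)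
    -- A crossing half-edge on the opposite side has its mate on the side of `h₀`, so that mate is
    -- `h₀`.
    ... | no ne = there (here (trans (sym (mate-invol h)) (cong (mate g) (bridge (mate g h) h₀
            (λ eq → x (sym (trans eq (cong (side ∘ vert g) (mate-invol h))))) x₀
            (trans (Boolₚ.¬-not (x ∘ sym)) (sym (Boolₚ.¬-not (ne ∘ sym))))))))

-- By `branch`, an edge that avoids the centre is monochromatic, so only edges at the centre have to
-- be excluded.
Tripod-robust : ∀ {b} → Robust {n} (Tripod b)
Tripod-robust {n} {b} = record { invariant = inv ; stable = stb }
  where
  inv : ∀ g g′ → Iso g g′ → Tripod b g → Tripod b g′
  inv g g′ i tr = record
    { centre = πV ⟨$⟩ʳ centre
    ; colour = colour ∘ (πV ⟨$⟩ˡ_)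
    ; colour-0 = λ v eq → trans (sym (inverseʳ πV)) (cong (πV ⟨$⟩ʳ_) (colour-0 _ eq))
    ; branch = λ h ne ne′ → trans (cong colour (vert-back h))
        (trans (branch _ (ne ∘ trans (cong colour (vert-back h))) (ne′ ∘ trans (cong colour (vert-mate-back h))))
          (cong colour (sym (vert-mate-back h))))
    ; code = code ∘ (πV ⟨$⟩ˡ_)
    ; code-inj = λ u v c≡ eq → perm-injective (Data.Fin.Permutation.flip πV) (code-inj _ _ c≡ eq) }
    where
    open Tripod tr
    open Back g g′ i
    πV = proj₁ i
  stb : ∀ g → ConnectedCubic g → Tripod b g →
    Σ (List (Fin (6 * n))) λ hs → length hs ≤ 6 × (∀ s h → h ∉ hs → Tripod b (whitehead s g h))
  stb g (cubic , _) tr with any? (λ h → colour (vert g h) ≟ 0F)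
    where open Tripod tr
  ... | no none = [] , z≤n , λ s h _ → uncurry (Tripod-transport tr) (whitehead-colour cubic colour s h
          (branch h (λ eq → none (h , eq)) (λ eq → none (mate g h , eq))))
    where open Tripod tr
  ... | yes (h₀ , h₀-centre) with othersAt-pair cubic h₀
  ... | a₀ , b₀ , _ , o = h₀ ∷ a₀ ∷ b₀ ∷ mate g h₀ ∷ mate g a₀ ∷ mate g b₀ ∷ [] , ℕₚ.≤-refl ,
          λ s h h∉ → uncurry (Tripod-transport tr) (whitehead-colour cubic colour s h
            (branch h (λ eq → h∉ (near (Others.only o h (at eq)))) (λ eq → h∉ (near′ (Others.only o (mate g h) (at eq))))))
    where
    open Tripod tr
    open IsCubic cubic
    at : ∀ {e} → colour (vert g e) ≡ 0F → vert g e ≡ vert g h₀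
    at eq = trans (colour-0 _ eq) (sym (colour-0 _ h₀-centre))
    near : ∀ {h} → h ≡ h₀ ⊎ h ≡ a₀ ⊎ h ≡ b₀ → h ∈ h₀ ∷ a₀ ∷ b₀ ∷ mate g h₀ ∷ mate g a₀ ∷ mate g b₀ ∷ []
    near (inj₁ eq) = here eq
    near (inj₂ (inj₁ eq)) = there (here eq)
    near (inj₂ (inj₂ eq)) = there (there (here eq))
    near′ : ∀ {h} → mate g h ≡ h₀ ⊎ mate g h ≡ a₀ ⊎ mate g h ≡ b₀ →
      h ∈ h₀ ∷ a₀ ∷ b₀ ∷ mate g h₀ ∷ mate g a₀ ∷ mate g b₀ ∷ []
    near′ (inj₁ refl) = there (there (there (here (sym (mate-invol _)))))
    near′ (inj₂ (inj₁ refl)) = there (there (there (there (here (sym (mate-invol _))))))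
    near′ (inj₂ (inj₂ refl)) = there (there (there (there (there (here (sym (mate-invol _)))))))

-- Examples: chains of beads

-- A chain of N beads: bead i is an edge (its rung) between its vertices 0 and 1; vertex 1 of bead i
-- is joined to vertex 0 of bead i + 1 by two edges (strands), and loops close the two ends.
-- Half-edges 0, 1, 2 of a bead sit at vertex 0 and 3, 4, 5 at vertex 1; 0 and 3 form the rung.
module Beads (n′ : ℕ) where

  N : ℕ
  N = suc n′

  end : Fin 6 → Fin 2
  end 0F = 0F
  end 1F = 0F
  end 2F = 0F
  end 3F = 1F
  end 4F = 1F
  end 5F = 1F

  -- At the last bead half-edges 4 and 5 form the closing loop, and `t′` is the other one of the
  -- two.
  up : Fin 6 → Fin 6 → (i : Fin N) → Fin 6 × Fin N
  up t t′ i with view i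
  ... | ‵fromℕ = t′ , i
  ... | ‵inj₁ {i = j} _ = t , suc j

  partner : Fin 6 → Fin N → Fin 6 × Fin N
  partner 0F i = 3F , i
  partner 1F zero = 2F , zero
  partner 1F (suc i) = 4F , inject₁ i
  partner 2F zero = 1F , zero
  partner 2F (suc i) = 5F , inject₁ i
  partner 3F i = 0F , i
  partner 4F i = up 1F 5F i
  partner 5F i = up 2F 4F i

  up-fromℕ : ∀ t t′ → up t t′ (fromℕ n′) ≡ (t′ , fromℕ n′)
  up-fromℕ t t′ rewrite view-fromℕ n′ = refl

  up-inject₁ : ∀ t t′ j → up t t′ (inject₁ j) ≡ (t , suc j)
  up-inject₁ t t′ j rewrite view-inject₁ j = refl

  partner-involutive : ∀ t i → uncurry partner (partner t i) ≡ (t , i)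
  partner-involutive 0F i = refl
  partner-involutive 1F zero = refl
  partner-involutive 1F (suc i) = up-inject₁ 1F 5F i
  partner-involutive 2F zero = refl
  partner-involutive 2F (suc i) = up-inject₁ 2F 4F i
  partner-involutive 3F i = refl
  partner-involutive 4F i with view i
  ... | ‵fromℕ = up-fromℕ 2F 4F
  ... | ‵inj₁ _ = refl
  partner-involutive 5F i with view i
  ... | ‵fromℕ = up-fromℕ 1F 5F
  ... | ‵inj₁ _ = refl

  partner-nofix : ∀ t i → proj₁ (partner t i) ≢ t
  partner-nofix 0F i ()
  partner-nofix 1F zero ()
  partner-nofix 1F (suc i) ()
  partner-nofix 2F zero ()
  partner-nofix 2F (suc i) ()
  partner-nofix 3F i ()
  partner-nofix 4F i with view i
  ... | ‵fromℕ = λ ()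
  ... | ‵inj₁ _ = λ ()
  partner-nofix 5F i with view i
  ... | ‵fromℕ = λ ()
  ... | ‵inj₁ _ = λ ()

  abstract
    -- Opaque, so that goals keep an end or a type together with a bead instead of arithmetic in
    -- `Fin`.
    vertex : Fin 2 → Fin N → Fin (2 * N)
    vertex = combine

    half : Fin 6 → Fin N → Fin (6 * N)
    half = combine

    vertex-parts : Fin (2 * N) → Fin 2 × Fin N
    vertex-parts = remQuot N

    half-parts : Fin (6 * N) → Fin 6 × Fin N
    half-parts = remQuot N

    parts-vertex : ∀ s i → vertex-parts (vertex s i) ≡ (s , i)
    parts-vertex = remQuot-combine

    parts-half : ∀ t i → half-parts (half t i) ≡ (t , i)
    parts-half = remQuot-combine

    vertex-of-parts : ∀ v → uncurry vertex (vertex-parts v) ≡ v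
    vertex-of-parts = combine-remQuot {2} N

    half-of-parts : ∀ h → uncurry half (half-parts h) ≡ h
    half-of-parts = combine-remQuot {6} N

  vertex-injective : ∀ {s i s′ i′} → vertex s i ≡ vertex s′ i′ → (s , i) ≡ (s′ , i′)
  vertex-injective eq = trans (sym (parts-vertex _ _)) (trans (cong vertex-parts eq) (parts-vertex _ _))

  half-injective : ∀ {t i t′ i′} → half t i ≡ half t′ i′ → (t , i) ≡ (t′ , i′)
  half-injective eq = trans (sym (parts-half _ _)) (trans (cong half-parts eq) (parts-half _ _))

  each-half : (Q : Fin (6 * N) → Set) → (∀ t i → Q (half t i)) → ∀ h → Q h
  each-half Q q h = subst Q (half-of-parts h) (q _ _)

  each-vertex : (Q : Fin (2 * N) → Set) → (∀ s i → Q (vertex s i)) → ∀ v → Q v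
  each-vertex Q q v = subst Q (vertex-of-parts v) (q _ _)

  beads : RawCubic N
  beads = mkRaw (λ h → let t , i = half-parts h in vertex (end t) i)
                (λ h → uncurry half (uncurry partner (half-parts h)))

  vert-half : ∀ t i → vert beads (half t i) ≡ vertex (end t) i
  vert-half t i = cong (λ p → vertex (end (proj₁ p)) (proj₂ p)) (parts-half t i)

  mate-half : ∀ t i → mate beads (half t i) ≡ uncurry half (partner t i)
  mate-half t i = cong (λ p → uncurry half (uncurry partner p)) (parts-half t i)

  mate-half-at : ∀ {t i t′ i′} → partner t i ≡ (t′ , i′) → mate beads (half t i) ≡ half t′ i′
  mate-half-at eq = trans (mate-half _ _) (cong (uncurry half) eq)

  beads-mate-invol : ∀ h → mate beads (mate beads h) ≡ h
  beads-mate-invol = each-half _ λ t i → trans (cong (mate beads) (mate-half t i))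
    (trans (mate-half _ _) (cong (uncurry half) (partner-involutive t i)))

  halves-at : Fin 2 → Fin N → List (Fin (6 * N))
  halves-at 0F i = half 0F i ∷ half 1F i ∷ half 2F i ∷ []
  halves-at 1F i = half 3F i ∷ half 4F i ∷ half 5F i ∷ []

  halves-unique : ∀ s i → Unique (halves-at s i)
  halves-unique 0F i = (ne (λ ()) ∷ ne (λ ()) ∷ []) ∷ (ne (λ ()) ∷ []) ∷ [] ∷ []
    where
    ne : ∀ {t t′} → t ≢ t′ → half t i ≢ half t′ i
    ne t≢ eq = t≢ (cong proj₁ (half-injective eq))
  halves-unique 1F i = (ne (λ ()) ∷ ne (λ ()) ∷ []) ∷ (ne (λ ()) ∷ []) ∷ [] ∷ []
    where
    ne : ∀ {t t′} → t ≢ t′ → half t i ≢ half t′ i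
    ne t≢ eq = t≢ (cong proj₁ (half-injective eq))

  halves-sound : ∀ s i {h} → h ∈ halves-at s i → vert beads h ≡ vertex s i
  halves-sound 0F i (here refl) = vert-half _ _
  halves-sound 0F i (there (here refl)) = vert-half _ _
  halves-sound 0F i (there (there (here refl))) = vert-half _ _
  halves-sound 1F i (here refl) = vert-half _ _
  halves-sound 1F i (there (here refl)) = vert-half _ _
  halves-sound 1F i (there (there (here refl))) = vert-half _ _

  halves-complete : ∀ t i → half t i ∈ halves-at (end t) i
  halves-complete 0F i = here refl
  halves-complete 1F i = there (here refl)
  halves-complete 2F i = there (there (here refl))
  halves-complete 3F i = here refl
  halves-complete 4F i = there (here refl)
  halves-complete 5F i = there (there (here refl))

  halves-length : ∀ s i → length (halves-at s i) ≡ 3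
  halves-length 0F i = refl
  halves-length 1F i = refl

  beads-degree : ∀ s i → degree beads (vertex s i) ≡ 3
  beads-degree s i = trans (ℕₚ.≤-antisym
    (count-≤-length (λ h → vert beads h ≟ vertex s i) (halves-at s i)
      (each-half _ λ t j eq → listed (vertex-injective (trans (sym (vert-half t j)) eq))))
    (length-≤-count (λ h → vert beads h ≟ vertex s i) (halves-unique s i) (halves-sound s i))) (halves-length s i)
    where
    listed : ∀ {t j s i} → (end t , j) ≡ (s , i) → half t j ∈ halves-at s i
    listed refl = halves-complete _ _

  beads-edge : ∀ t i {t′ i′} → partner t i ≡ (t′ , i′) → Adj beads (vertex (end t) i) (vertex (end t′) i′)
  beads-edge t i eq = half t i , vert-half t i , trans (cong (vert beads) (mate-half-at eq)) (vert-half _ _)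

  beads-connected : Connected beads
  beads-connected u v = reverse flip-adj (from-zero u) ◅◅ from-zero v
    where
    flip-adj : ∀ {u v} → Adj beads u v → Adj beads v u
    flip-adj (h , refl , refl) = mate beads h , refl , cong (vert beads) (beads-mate-invol h)
    origin = vertex 0F zero
    to-0 : ∀ i → Star (Adj beads) origin (vertex 0F i)
    to-0 = <-weakInduction _ ε λ i walk → walk ◅◅ beads-edge 0F (inject₁ i) refl ◅ beads-edge 4F (inject₁ i) (up-inject₁ 1F 5F i) ◅ ε
    from-zero : ∀ v → Star (Adj beads) origin v
    from-zero = each-vertex _ λ { 0F i → to-0 i ; 1F i → to-0 i ◅◅ beads-edge 0F i refl ◅ ε }

  beads-connectedCubic : ConnectedCubic beads
  beads-connectedCubic = record
    { mate-invol = beads-mate-invol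
    ; mate-nofix = each-half _ λ t i eq → partner-nofix t i (cong proj₁ (half-injective (trans (sym (mate-half t i)) eq)))
    ; deg3 = each-vertex _ beads-degree } , beads-connected

  -- Strands join vertices of equal level, and the rung of bead i joins levels i and i + 1.
  level : Fin 2 → Fin N → ℕ
  level 0F i = toℕ i
  level 1F i = suc (toℕ i)

  levelᵛ : Fin (2 * N) → ℕ
  levelᵛ v = uncurry level (vertex-parts v)

  level-vertex : ∀ s i → levelᵛ (vertex s i) ≡ level s i
  level-vertex s i = cong (uncurry level) (parts-vertex s i)

  module _ (e : ℕ) where

    below : ℕ → Bool
    below l with l ≤? e
    ... | yes _ = true
    ... | no _ = false

    below-yes : ∀ {l} → l ≤ e → below l ≡ true
    below-yes {l} l≤e with l ≤? e
    ... | yes _ = refl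
    ... | no l≰e = ⊥-elim (l≰e l≤e)

    below-no : ∀ {l} → e < l → below l ≡ false
    below-no {l} e<l with l ≤? e
    ... | yes l≤e = ⊥-elim (ℕₚ.<⇒≱ e<l l≤e)
    ... | no _ = refl

    side′ : Fin (2 * N) → Bool
    side′ v = below (levelᵛ v)

    side-half : ∀ t i → side′ (vert beads (half t i)) ≡ below (level (end t) i)
    side-half t i = cong below (trans (cong levelᵛ (vert-half t i)) (level-vertex (end t) i))

    rung-crossing : ∀ {l} → below l ≢ below (suc l) → l ≡ e
    rung-crossing {l} ne with ℕₚ.<-cmp l e
    ... | tri< l<e _ _ = ⊥-elim (ne (trans (below-yes (ℕₚ.<⇒≤ l<e)) (sym (below-yes l<e))))
    ... | tri≈ _ l≡e _ = l≡e
    ... | tri> _ _ e<l = ⊥-elim (ne (trans (below-no e<l) (sym (below-no (ℕₚ.m<n⇒m<1+n e<l)))))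

    -- Strands and end loops stay within a level and never cross. The rung of bead `i` joins levels
    -- `i` and `i + 1`, so it crosses only for `i = e`; its lower end is half-edge 0, its upper end
    -- half-edge 3.
    crossing-rung : ∀ t i → Crosses beads side′ (half t i) →
      toℕ i ≡ e × t ≡ (if side′ (vert beads (half t i)) then 0F else 3F)
    crossing-rung t i x = cases t refl
      where
      x′ : ∀ {t i t′ i′} → partner t i ≡ (t′ , i′) → Crosses beads side′ (half t i) → below (level (end t) i) ≢ below (level (end t′) i′)
      x′ eq x same = x (trans (side-half _ _) (trans same (trans (sym (side-half _ _)) (cong (side′ ∘ vert beads) (sym (mate-half-at eq))))))
      cases : ∀ t′ → t ≡ t′ → toℕ i ≡ e × t ≡ (if side′ (vert beads (half t i)) then 0F else 3F)
      cases 0F refl = i≡e , sym (cong (λ b → if b then 0F else 3F) (trans (side-half t i) (below-yes (ℕₚ.≤-reflexive i≡e))))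
        where i≡e = rung-crossing (x′ {0F} {i} refl x)
      cases 3F refl = i≡e , sym (cong (λ b → if b then 0F else 3F) (trans (side-half t i) (below-no (s≤s (ℕₚ.≤-reflexive (sym i≡e))))))
        where i≡e = rung-crossing (x′ {3F} {i} refl x ∘ sym)
      cases 1F refl = ⊥-elim (strand i x)
        where
        strand : ∀ i → ¬ Crosses beads side′ (half 1F i)
        strand zero x = x′ {1F} {zero} refl x refl
        strand (suc i) x = x′ {1F} {suc i} refl x (cong (below ∘ suc) (sym (toℕ-inject₁ i)))
      cases 2F refl = ⊥-elim (strand i x)
        where
        strand : ∀ i → ¬ Crosses beads side′ (half 2F i)
        strand zero x = x′ {2F} {zero} refl x refl
        strand (suc i) x = x′ {2F} {suc i} refl x (cong (below ∘ suc) (sym (toℕ-inject₁ i)))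
      cases 4F refl with view i
      ... | ‵fromℕ = ⊥-elim (x′ {4F} (up-fromℕ 1F 5F) x refl)
      ... | ‵inj₁ {i = j} _ = ⊥-elim (x′ {4F} (up-inject₁ 1F 5F j) x (cong (below ∘ suc) (toℕ-inject₁ j)))
      cases 5F refl with view i
      ... | ‵fromℕ = ⊥-elim (x′ {5F} (up-fromℕ 2F 4F) x refl)
      ... | ‵inj₁ {i = j} _ = ⊥-elim (x′ {5F} (up-inject₁ 2F 4F j) x (cong (below ∘ suc) (toℕ-inject₁ j)))

    side-bridge : ∀ h h′ → Crosses beads side′ h → Crosses beads side′ h′ →
      side′ (vert beads h) ≡ side′ (vert beads h′) → h ≡ h′
    side-bridge = each-half _ λ t i → each-half _ λ t′ i′ x x′ same →
      let i≡ , t≡ = crossing-rung t i x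
          i′≡ , t′≡ = crossing-rung t′ i′ x′
      in cong₂ half (trans t≡ (trans (cong (λ b → if b then 0F else 3F) same) (sym t′≡))) (toℕ-injective (trans i≡ (sym i′≡)))

  beads-split : ∀ a → a + suc a ≤ N → Split (2 * a) beads
  beads-split a a+a<N = record
    { side = side′ a ; bridge = side-bridge a ; sample = sample ; sample-inj = sample-inj ; sample-in = sample-in }
    where
    -- Bead `a` carries the bridge and is skipped: beads `0` to `a - 1` lie wholly on one side,
    -- beads `a + 1` to `2a` on the other.
    offset : Bool → ℕ
    offset true = 0
    offset false = suc a
    in-range : ∀ s (j : Fin a) → offset s + toℕ j < N
    in-range true j = ℕₚ.≤-trans (toℕ<n j) (ℕₚ.≤-trans (ℕₚ.m≤m+n a (suc a)) a+a<N)
    in-range false j = ℕₚ.≤-trans (s≤s (ℕₚ.+-monoʳ-< a (toℕ<n j))) (ℕₚ.≤-trans (ℕₚ.≤-reflexive (sym (ℕₚ.+-suc a a))) a+a<N)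
    bead : Bool → Fin a → Fin N
    bead s j = fromℕ< (in-range s j)
    sample : Bool → Fin (2 * a) → Fin (2 * N)
    sample s q = let r , j = remQuot {2} a q in vertex r (bead s j)
    sample-inj : ∀ s {q q′} → sample s q ≡ sample s q′ → q ≡ q′
    sample-inj s {q} {q′} eq = trans (sym (combine-remQuot {2} a q)) (trans (cong₂ combine r≡ j≡) (combine-remQuot {2} a q′))
      where
      parts = vertex-injective eq
      r≡ = cong proj₁ parts
      j≡ = toℕ-injective (ℕₚ.+-cancelˡ-≡ (offset s) _ _
        (fromℕ<-injective _ _ (in-range s _) (in-range s _) (cong proj₂ parts)))
    sided : ∀ s r (j : Fin a) → below a (level r (bead s j)) ≡ s
    sided true 0F j = below-yes a (ℕₚ.≤-trans (ℕₚ.≤-reflexive (toℕ-fromℕ< (in-range true j))) (ℕₚ.<⇒≤ (toℕ<n j)))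
    sided true 1F j = below-yes a (ℕₚ.≤-trans (s≤s (ℕₚ.≤-reflexive (toℕ-fromℕ< (in-range true j)))) (toℕ<n j))
    sided false 0F j = below-no a (ℕₚ.≤-trans (s≤s (ℕₚ.m≤m+n a (toℕ j))) (ℕₚ.≤-reflexive (sym (toℕ-fromℕ< (in-range false j)))))
    sided false 1F j = below-no a (s≤s (ℕₚ.≤-trans (ℕₚ.m≤n⇒m≤1+n (ℕₚ.m≤m+n a (toℕ j))) (ℕₚ.≤-reflexive (sym (toℕ-fromℕ< (in-range false j))))))
    sample-in : ∀ s q → side′ a (sample s q) ≡ s
    sample-in s q = let r , j = remQuot {2} a q in trans (cong (below a) (level-vertex r (bead s j))) (sided s r j)

  -- Swapping a strand half-edge at vertex 1 of bead c with a rung half-edge of a later bead d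
  -- makes vertex 1 of bead c a cut vertex with three branches.
  module Fork (P : ClassPresentation N) (c d : Fin N) (c<d : toℕ c < toℕ d) where

    open Reach P using (module Slide; ok)

    -- One of the two strands between neighbouring beads, and the rungs other than that of `d`.
    -- Half-edges 2 and 5 remain spare at every vertex, and leaving out the rung of `d` frees `k`.
    data Spine : Fin 6 → Fin N → Set where
      rung₀   : ∀ {i} → i ≢ d → Spine 0F i
      rung₁   : ∀ {i} → i ≢ d → Spine 3F i
      strand₀ : ∀ j → Spine 1F (suc j)
      strand₁ : ∀ j → Spine 4F (inject₁ j)

    OnSpine : Fin (6 * N) → Set
    OnSpine h = ∃ λ t → ∃ λ i → h ≡ half t i × Spine t i

    OnSpine-mate : ∀ {h} → OnSpine h → OnSpine (mate beads h)
    OnSpine-mate (_ , i , refl , rung₀ i≢d) = 3F , i , mate-half 0F i , rung₁ i≢d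
    OnSpine-mate (_ , i , refl , rung₁ i≢d) = 0F , i , mate-half 3F i , rung₀ i≢d
    OnSpine-mate (_ , _ , refl , strand₀ j) = 4F , inject₁ j , mate-half 1F (suc j) , strand₁ j
    OnSpine-mate (_ , _ , refl , strand₁ j) = 1F , suc j , mate-half-at (up-inject₁ 1F 5F j) , strand₀ j

    open Slide (mate beads) (vert beads) OnSpine OnSpine-mate

    off-spine : ∀ {t i} → ¬ Spine t i → ¬ OnSpine (half t i)
    off-spine ¬spine (_ , _ , eq , spine) with refl ← half-injective eq = ¬spine spine

    room : ∀ {h} → OnSpine h → ∃ λ y → vert beads y ≡ vert beads h × ¬ OnSpine y
    room (t , i , refl , _) = half (free (end t)) i , trans (vert-half _ i) (trans (cong (λ s → vertex s i) (end-free (end t))) (sym (vert-half t i)))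
      , off-spine (¬spine (end t))
      where
      free : Fin 2 → Fin 6
      free 0F = 2F
      free 1F = 5F
      end-free : ∀ s → end (free s) ≡ s
      end-free 0F = refl
      end-free 1F = refl
      ¬spine : ∀ s → ¬ Spine (free s) i
      ¬spine 0F ()
      ¬spine 1F ()

    walk-step : ∀ {t i t′ i′} → Spine t i → partner t i ≡ (t′ , i′) → Walk (vertex (end t) i) (vertex (end t′) i′)
    walk-step {t} {i} spine eq = subst₂ Walk (vert-half t i) (trans (cong (vert beads) (mate-half-at eq)) (vert-half _ _))
      (step (half t i) (t , i , refl , spine) [])

    walk-to : ∀ i → toℕ c < toℕ i → toℕ i ≤ toℕ d → Walk (vertex 1F c) (vertex 0F i)
    walk-to = <-weakInduction _ (λ ()) λ i walk c<i i≤d → extend i walk (ℕₚ.m≤n⇒m<n∨m≡n (ℕₚ.≤-pred c<i)) i≤d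
      where
      extend : ∀ i → (toℕ c < toℕ (inject₁ i) → toℕ (inject₁ i) ≤ toℕ d → Walk (vertex 1F c) (vertex 0F (inject₁ i))) →
        toℕ c < toℕ i ⊎ toℕ c ≡ toℕ i → toℕ (suc i) ≤ toℕ d → Walk (vertex 1F c) (vertex 0F (suc i))
      extend i walk (inj₂ c≡i) i<d = subst (λ k → Walk (vertex 1F k) (vertex 0F (suc i)))
        (toℕ-injective (trans (toℕ-inject₁ i) (sym c≡i))) (walk-step (strand₁ i) (up-inject₁ 1F 5F i))
      extend i walk (inj₁ c<i) i<d =
        (walk (subst (toℕ c <_) (sym (toℕ-inject₁ i)) c<i) (ℕₚ.≤-trans (ℕₚ.≤-reflexive (toℕ-inject₁ i)) (ℕₚ.<⇒≤ i<d))
          ++ʷ walk-step (rung₀ λ i≡d → ℕₚ.<⇒≢ i<d (trans (sym (toℕ-inject₁ i)) (cong toℕ i≡d))) refl)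
          ++ʷ walk-step (strand₁ i) (up-inject₁ 1F 5F i)

    x k : Fin (6 * N)
    x = half 5F c
    k = half 0F d

    fork : RawCubic N
    fork = beads [ x ↔ k ]

    -- The beads `c` and `d` may be far apart, so the swap need not be a single move; its
    -- connectedness comes from sliding along the spine.
    fork-connectedCubic : ConnectedCubic fork
    fork-connectedCubic = ok (slide (record { cc = beads-connectedCubic ; fixed = λ _ → refl ; room = room })
      (off-spine λ ()) (off-spine λ { (rung₀ d≢d) → d≢d refl }) (λ eq → case-≢ (cong proj₁ (half-injective eq)))
      (vert-half 5F c) (vert-half 0F d) (walk-to d c<d ℕₚ.≤-refl))
      where
      case-≢ : ¬ (Fin.suc {5} 4F ≡ 0F)
      case-≢ ()

    C D : ℕ
    C = toℕ c
    D = toℕ d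

    centre : Fin (2 * N)
    centre = vertex 1F c

    -- After the swap the centre is joined to branch 1 by the rung of `c`, to branch 2 by the
    -- remaining strand of `c`, and to branch 3 by the rung of `d`, whose lower half-edge `k` now
    -- sits there. The strand of `x` now ends at vertex 0 of `d` and stays inside branch 2.
    branchOf : ℕ → Fin 4
    branchOf l with l ≤? C | l ≤? D
    ... | yes _ | _ = 1F
    ... | no _ | yes _ = 2F
    ... | no _ | no _ = 3F

    branch-1 : ∀ {l} → l ≤ C → branchOf l ≡ 1F
    branch-1 {l} l≤C with l ≤? C | l ≤? D
    ... | yes _ | _ = refl
    ... | no l≰C | _ = ⊥-elim (l≰C l≤C)

    branch-2 : ∀ {l} → C < l → l ≤ D → branchOf l ≡ 2F
    branch-2 {l} C<l l≤D with l ≤? C | l ≤? D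
    ... | yes l≤C | _ = ⊥-elim (ℕₚ.<⇒≱ C<l l≤C)
    ... | no _ | yes _ = refl
    ... | no _ | no l≰D = ⊥-elim (l≰D l≤D)

    branch-3 : ∀ {l} → D < l → branchOf l ≡ 3F
    branch-3 {l} D<l with l ≤? C | l ≤? D
    ... | yes l≤C | _ = ⊥-elim (ℕₚ.<⇒≱ (ℕₚ.<-trans c<d D<l) l≤C)
    ... | no _ | yes l≤D = ⊥-elim (ℕₚ.<⇒≱ D<l l≤D)
    ... | no _ | no _ = refl

    colour : Fin (2 * N) → Fin 4
    colour v with v ≟ centre
    ... | yes _ = 0F
    ... | no _ = branchOf (levelᵛ v)

    colour-centre : ∀ {v} → v ≡ centre → colour v ≡ 0F
    colour-centre {v} eq with v ≟ centre
    ... | yes _ = refl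
    ... | no ne = ⊥-elim (ne eq)

    colour-branch : ∀ {v} → v ≢ centre → colour v ≡ branchOf (levelᵛ v)
    colour-branch {v} ne with v ≟ centre
    ... | yes eq = ⊥-elim (ne eq)
    ... | no _ = refl

    branchOf-≢0 : ∀ l → branchOf l ≢ 0F
    branchOf-≢0 l with l ≤? C | l ≤? D
    ... | yes _ | _ = λ ()
    ... | no _ | yes _ = λ ()
    ... | no _ | no _ = λ ()

    colour-0 : ∀ v → colour v ≡ 0F → v ≡ centre
    colour-0 v eq with v ≟ centre
    ... | yes v≡ = v≡
    ... | no _ = ⊥-elim (branchOf-≢0 _ eq)

    colour-half : ∀ {t i} → vertex (end t) i ≢ centre → half t i ≢ x → half t i ≢ k →
      colour (vert fork (half t i)) ≡ branchOf (level (end t) i)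
    colour-half {t} {i} ≢c ≢x ≢k = trans (cong (colour ∘ vert beads) (τ-other x k ≢x ≢k))
      (trans (cong colour (vert-half t i)) (trans (colour-branch ≢c) (cong branchOf (level-vertex (end t) i))))

    Agrees : Fin (6 * N) → Set
    Agrees h = colour (vert fork h) ≢ 0F → colour (vert fork (mate beads h)) ≢ 0F →
      colour (vert fork h) ≡ colour (vert fork (mate beads h))

    agrees-mate : ∀ {h} → Agrees (mate beads h) → Agrees h
    agrees-mate {h} a ne ne′ = trans (cong (colour ∘ vert fork) (sym back)) (sym (a ne′ (ne ∘ trans (sym (cong (colour ∘ vert fork) back)))))
      where back = beads-mate-invol h

    ≢-type : ∀ {t i t′ i′} → t ≢ t′ → half t i ≢ half t′ i′
    ≢-type t≢ eq = t≢ (cong proj₁ (half-injective eq))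

    ≢-end : ∀ {i s} → s ≢ 1F → vertex s i ≢ centre
    ≢-end s≢ eq = s≢ (cong proj₁ (vertex-injective eq))

    rung-agrees : ∀ i → Agrees (half 0F i)
    rung-agrees i ne ne′ with i ≟ d
    -- Half-edge 0 of bead `d` is `k`, which the swap has brought to the centre.
    ... | yes refl = ⊥-elim (ne (colour-centre (trans (cong (vert beads) (τ-right x k)) (vert-half 5F c))))
    ... | no i≢d = trans left-colour (trans same (sym right-colour))
      where
      mate≡ : mate beads (half 0F i) ≡ half 3F i
      mate≡ = mate-half 0F i
      i≢c : i ≢ c
      i≢c refl = ne′ (colour-centre (trans (cong (vert fork) mate≡)
        (trans (cong (vert beads) (τ-other x k (≢-type λ ()) (≢-type λ ()))) (vert-half 3F c))))
      left-colour : colour (vert fork (half 0F i)) ≡ branchOf (toℕ i)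
      left-colour = colour-half {0F} (≢-end λ ()) (≢-type λ ()) (i≢d ∘ cong proj₂ ∘ half-injective)
      right-colour : colour (vert fork (mate beads (half 0F i))) ≡ branchOf (suc (toℕ i))
      right-colour = trans (cong (colour ∘ vert fork) mate≡)
        (colour-half {3F} (i≢c ∘ cong proj₂ ∘ vertex-injective) (≢-type λ ()) (≢-type λ ()))
      same : branchOf (toℕ i) ≡ branchOf (suc (toℕ i))
      same with ℕₚ.<-cmp (toℕ i) C | ℕₚ.<-cmp (toℕ i) D
      ... | tri< i<C _ _ | _ = trans (branch-1 (ℕₚ.<⇒≤ i<C)) (sym (branch-1 i<C))
      ... | tri≈ _ i≡C _ | _ = ⊥-elim (i≢c (toℕ-injective i≡C))
      ... | tri> _ _ C<i | tri< i<D _ _ = trans (branch-2 C<i (ℕₚ.<⇒≤ i<D)) (sym (branch-2 (ℕₚ.m<n⇒m<1+n C<i) i<D))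
      ... | tri> _ _ _ | tri≈ _ i≡D _ = ⊥-elim (i≢d (toℕ-injective i≡D))
      ... | tri> _ _ _ | tri> _ _ D<i = trans (branch-3 D<i) (sym (branch-3 (ℕₚ.m<n⇒m<1+n D<i)))

    loop-agrees : ∀ {t t′ i} → end t ≡ end t′ → partner t i ≡ (t′ , i) →
      half t i ≢ x → half t′ i ≢ x → half t i ≢ k → half t′ i ≢ k → Agrees (half t i)
    loop-agrees {t} {t′} {i} same eq t≢x t′≢x t≢k t′≢k _ _ = cong colour (trans (cong (vert beads) (τ-other x k t≢x t≢k))
      (trans (vert-half t i) (trans (cong (λ s → vertex s i) same) (sym (trans (cong (vert fork) (mate-half-at eq))
        (trans (cong (vert beads) (τ-other x k t′≢x t′≢k)) (vert-half t′ i)))))))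

    c-not-last : fromℕ n′ ≢ c
    c-not-last eq = ℕₚ.<⇒≱ c<d (ℕₚ.≤-trans (ℕₚ.≤-pred (toℕ<n d)) (ℕₚ.≤-reflexive (trans (sym (toℕ-fromℕ n′)) (cong toℕ eq))))

    -- Away from `c` both ends have the same level. At `c`, half-edge 4 is at the centre, which is
    -- excluded, while half-edge 5 is the moved `x`, now at level `D`; its mate has level `C + 1`,
    -- and both belong to branch 2.
    strand-agrees : ∀ {t t′} j → end t ≡ 1F → end t′ ≡ 0F → partner t (inject₁ j) ≡ (t′ , suc j) →
      half t (inject₁ j) ≢ k → half t′ (suc j) ≢ x → half t′ (suc j) ≢ k → t ≡ 5F ⊎ (∀ i → half t i ≢ x) → Agrees (half t (inject₁ j))
    strand-agrees {t} {t′} j t-end t′-end eq t≢k t′≢x t′≢k which ne ne′ with inject₁ j ≟ c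
    ... | no j≢c = trans (colour-half {t} (j≢c ∘ cong proj₂ ∘ vertex-injective) (j≢c ∘ cong proj₂ ∘ half-injective) t≢k)
            (trans (cong branchOf (trans (cong (λ s → level s (inject₁ j)) t-end) (cong suc (toℕ-inject₁ j)))) (sym far))
      where
      far : colour (vert fork (mate beads (half t (inject₁ j)))) ≡ branchOf (suc (toℕ j))
      far = trans (cong (colour ∘ vert fork) (mate-half-at eq))
        (trans (colour-half {t′} (≢-end (λ e → case-≢ (trans (sym t′-end) e))) t′≢x t′≢k) (cong (λ s → branchOf (level s (suc j))) t′-end))
        where
        case-≢ : ¬ (Fin.zero {1} ≡ 1F)
        case-≢ ()
    strand-agrees {t} {t′} j t-end t′-end eq t≢k t′≢x t′≢k (inj₂ not-x) ne ne′ | yes refl =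
      ⊥-elim (ne (colour-centre (trans (cong (vert beads) (τ-other x k (not-x _) t≢k)) (trans (vert-half t _) (cong (λ s → vertex s c) t-end)))))
    strand-agrees {t} {t′} j t-end t′-end eq t≢k t′≢x t′≢k (inj₁ refl) ne ne′ | yes refl = trans near (sym far)
      where
      near : colour (vert fork (half 5F c)) ≡ 2F
      near = trans (cong (colour ∘ vert beads) (τ-left x k)) (trans (cong colour (vert-half 0F d))
        (trans (colour-branch (≢-end λ ())) (trans (cong branchOf (level-vertex 0F d)) (branch-2 c<d ℕₚ.≤-refl))))
      far : colour (vert fork (mate beads (half t (inject₁ j)))) ≡ 2F
      far = trans (cong (colour ∘ vert fork) (mate-half-at eq))
        (trans (colour-half {t′} (≢-end (λ e → case-≢ (trans (sym t′-end) e))) t′≢x t′≢k)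
          (trans (cong (λ s → branchOf (level s (suc j))) t′-end)
            (branch-2 (s≤s (ℕₚ.≤-reflexive (toℕ-inject₁ j))) (ℕₚ.≤-trans (s≤s (ℕₚ.≤-reflexive (sym (toℕ-inject₁ j)))) c<d))))
        where
        case-≢ : ¬ (Fin.zero {1} ≡ 1F)
        case-≢ ()

    agrees-4 : ∀ i → Agrees (half 4F i)
    agrees-4 i with view i
    ... | ‵fromℕ = loop-agrees {4F} refl (up-fromℕ 1F 5F) (≢-type λ ()) (c-not-last ∘ cong proj₂ ∘ half-injective) (≢-type λ ()) (≢-type λ ())
    ... | ‵inj₁ {i = j} _ = strand-agrees {4F} j refl refl (up-inject₁ 1F 5F j) (≢-type λ ()) (≢-type λ ()) (≢-type λ ()) (inj₂ λ i → ≢-type λ ())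

    agrees-5 : ∀ i → Agrees (half 5F i)
    agrees-5 i with view i
    ... | ‵fromℕ = loop-agrees {5F} refl (up-fromℕ 2F 4F) (c-not-last ∘ cong proj₂ ∘ half-injective) (≢-type λ ()) (≢-type λ ()) (≢-type λ ())
    ... | ‵inj₁ {i = j} _ = strand-agrees {5F} j refl refl (up-inject₁ 2F 4F j) (≢-type λ ()) (≢-type λ ()) (≢-type λ ()) (inj₁ refl)

    agrees : ∀ t i → Agrees (half t i)
    agrees 0F i = rung-agrees i
    agrees 1F zero = loop-agrees {1F} refl refl (≢-type λ ()) (≢-type λ ()) (≢-type λ ()) (≢-type λ ())
    agrees 1F (suc i) = agrees-mate (subst Agrees (sym (mate-half 1F (suc i))) (agrees-4 (inject₁ i)))
    agrees 2F zero = loop-agrees {2F} refl refl (≢-type λ ()) (≢-type λ ()) (≢-type λ ()) (≢-type λ ())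
    agrees 2F (suc i) = agrees-mate (subst Agrees (sym (mate-half 2F (suc i))) (agrees-5 (inject₁ i)))
    agrees 3F i = agrees-mate (subst Agrees (sym (mate-half 3F i)) (rung-agrees i))
    agrees 4F i = agrees-4 i
    agrees 5F i = agrees-5 i

    -- The lowest level of each branch; for colour 0 the level of the centre itself.
    first : Fin 4 → ℕ
    first 0F = suc C
    first 1F = 0
    first 2F = suc C
    first 3F = suc D

    -- The three bounds say that every branch spans at most `suc b` levels.
    module _ {b : ℕ} (C<b : C < suc b) (D< : D < suc C + suc b) (N< : N < suc D + suc b) where

      -- The default `zero` is never taken on the depths that occur, by `window`.
      clip : ℕ → Fin (suc b)
      clip l with l <? suc b
      ... | yes l<b = fromℕ< l<b
      ... | no _ = zero

      clip-injective : ∀ {l l′} → l < suc b → l′ < suc b → clip l ≡ clip l′ → l ≡ l′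
      clip-injective {l} {l′} l<b l′<b eq with l <? suc b | l′ <? suc b
      ... | yes p | yes q = fromℕ<-injective l l′ p q eq
      ... | no ¬p | _ = ⊥-elim (¬p l<b)
      ... | yes _ | no ¬q = ⊥-elim (¬q l′<b)

      Window : Fin 4 → ℕ → Set
      Window q l = first q ≤ l × l ∸ first q < suc b

      window-branch : ∀ l → l ≤ N → Window (branchOf l) l
      window-branch l l≤N with l ≤? C | l ≤? D
      ... | yes l≤C | _ = z≤n , ℕₚ.≤-<-trans l≤C C<b
      ... | no l≰C | yes l≤D = ℕₚ.≰⇒> l≰C , ℕₚ.m<n+o⇒m∸n<o l (suc C) (ℕₚ.≤-<-trans l≤D D<)
      ... | no _ | no l≰D = ℕₚ.≰⇒> l≰D , ℕₚ.m<n+o⇒m∸n<o l (suc D) (ℕₚ.≤-<-trans l≤N N<)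

      level-≤ : ∀ v → levelᵛ v ≤ N
      level-≤ v = uncurry bound (vertex-parts v)
        where
        bound : ∀ s i → level s i ≤ N
        bound 0F i = ℕₚ.<⇒≤ (toℕ<n i)
        bound 1F i = toℕ<n i

      window : ∀ v → Window (colour v) (levelᵛ v)
      window v with v ≟ centre
      ... | yes refl = ℕₚ.≤-reflexive (sym (level-vertex 1F c)) ,
              subst (λ l → l ∸ suc C < suc b) (sym (level-vertex 1F c)) (ℕₚ.≤-trans (s≤s (ℕₚ.≤-reflexive (ℕₚ.n∸n≡0 C))) (s≤s z≤n))
      ... | no _ = window-branch (levelᵛ v) (level-≤ v)

      -- A level holds at most one vertex 0 and one vertex 1, so the end within the bead and the
      -- depth within the branch determine a vertex of a given colour.
      code : Fin (2 * N) → Fin (2 * suc b)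
      code v = combine (proj₁ (vertex-parts v)) (clip (levelᵛ v ∸ first (colour v)))

      code-inj : ∀ u v → colour u ≡ colour v → code u ≡ code v → u ≡ v
      code-inj u v same eq = trans (sym (vertex-of-parts u)) (trans (cong (uncurry vertex) parts≡) (vertex-of-parts v))
        where
        split-eq = combine-injective _ _ _ _ eq
        depth≡ : levelᵛ u ∸ first (colour u) ≡ levelᵛ v ∸ first (colour v)
        depth≡ = clip-injective (proj₂ (window u)) (proj₂ (window v)) (proj₂ split-eq)
        level≡ : levelᵛ u ≡ levelᵛ v
        level≡ = trans (sym (ℕₚ.m∸n+n≡m (proj₁ (window u))))
          (trans (cong₂ _+_ depth≡ (cong first same)) (ℕₚ.m∸n+n≡m (proj₁ (window v))))
        level-inj : ∀ s {i j} → level s i ≡ level s j → i ≡ j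
        level-inj 0F eq = toℕ-injective eq
        level-inj 1F eq = toℕ-injective (ℕₚ.suc-injective eq)
        parts≡ : vertex-parts u ≡ vertex-parts v
        parts≡ = pair (vertex-parts u) (vertex-parts v) (proj₁ split-eq) level≡
          where
          pair : ∀ p q → proj₁ p ≡ proj₁ q → uncurry level p ≡ uncurry level q → p ≡ q
          pair (s , i) (_ , j) refl l≡ = cong (s ,_) (level-inj s l≡)

      fork-tripod : Tripod (2 * suc b) fork
      fork-tripod = record { centre = centre ; colour = colour ; colour-0 = colour-0 ; branch = each-half _ agrees
        ; code = code ; code-inj = code-inj }

-- Outer-conductance

sumOver-scale : ∀ {k} (a b : ℕ) (f g : Fin k → ℕ) xs → (∀ {x} → x ∈ xs → a * f x ≤ b * g x) →
  a * sumOver f xs ≤ b * sumOver g xs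
sumOver-scale a b f g [] _ = ℕₚ.≤-reflexive (trans (ℕₚ.*-zeroʳ a) (sym (ℕₚ.*-zeroʳ b)))
sumOver-scale a b f g (x ∷ xs) le = subst₂ _≤_ (sym (ℕₚ.*-distribˡ-+ a (f x) _)) (sym (ℕₚ.*-distribˡ-+ b (g x) _))
  (ℕₚ.+-mono-≤ (le (here refl)) (sumOver-scale a b f g xs (le ∘ there)))

sumOver-∈ : ∀ {k} (f : Fin k → ℕ) {x xs} → x ∈ xs → f x ≤ sumOver f xs
sumOver-∈ f {xs = _ ∷ xs} (here refl) = ℕₚ.m≤m+n _ _
sumOver-∈ f {xs = y ∷ _} (there x∈) = ℕₚ.≤-trans (sumOver-∈ f x∈) (ℕₚ.m≤n+m _ (f y))

sumOver-filter-≤ : ∀ {k} (f : Fin k → ℕ) {P Q : Fin k → Set} (P? : ∀ x → Dec (P x)) (Q? : ∀ x → Dec (Q x)) →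
  (∀ x → P x → Q x) → ∀ xs → sumOver f (filter P? xs) ≤ sumOver f (filter Q? xs)
sumOver-filter-≤ f P? Q? imp [] = z≤n
sumOver-filter-≤ f P? Q? imp (x ∷ xs) with P? x | Q? x | sumOver-filter-≤ f P? Q? imp xs
... | yes _ | yes _ | le = ℕₚ.+-monoʳ-≤ (f x) le
... | yes Px | no ¬Qx | _ = ⊥-elim (¬Qx (imp x Px))
... | no _ | yes _ | le = ℕₚ.≤-trans le (ℕₚ.m≤n+m _ (f x))
... | no _ | no _ | le = le

concatMap-pairs-length : (a b : A → B) → ∀ es → length (concatMap (λ e → a e ∷ b e ∷ []) es) ≡ length es * 2
concatMap-pairs-length a b [] = refl
concatMap-pairs-length a b (e ∷ es) = cong (2 ℕ.+_) (concatMap-pairs-length a b es)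

filter-pairs-length : {Q : B → Set} {R : A → Set} (Q? : ∀ y → Dec (Q y)) (R? : ∀ e → Dec (R e)) (a b : A → B) →
  (∀ e → ¬ R e → ¬ Q (a e) × ¬ Q (b e)) →
  ∀ es → length (filter Q? (concatMap (λ e → a e ∷ b e ∷ []) es)) ≤ length (filter R? es) * 2
filter-pairs-length Q? R? a b avoid [] = z≤n
filter-pairs-length Q? R? a b avoid (e ∷ es) with R? e | filter-pairs-length Q? R? a b avoid es
... | yes _ | le = ℕₚ.≤-trans (ℕₚ.≤-reflexive (trans (cong length (filter-++ Q? (a e ∷ b e ∷ []) rest))
        (length-++ (filter Q? (a e ∷ b e ∷ []))))) (ℕₚ.+-mono-≤ (length-filter Q? (a e ∷ b e ∷ [])) le)
  where rest = concatMap (λ e → a e ∷ b e ∷ []) es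
... | no ¬R | le = ℕₚ.≤-trans (ℕₚ.≤-reflexive (cong length
        (trans (filter-reject Q? (proj₁ (avoid e ¬R))) (filter-reject Q? (proj₂ (avoid e ¬R)))))) le

-- Exactly one half-edge of every edge is in edgeReps.
edgeReps-length : ∀ {n} (g : RawCubic n) → IsCubic g → 6 * n ≤ length (edgeReps g) * 2
edgeReps-length {n} g cubic = begin
  6 * n                          ≡⟨ length-tabulate {n = 6 * n} (λ i → i) ⟨
  length (allFin (6 * n))        ≤⟨ unique-⊆-length (Uniq.allFin⁺ _) (λ {h} _ → covered h) ⟩
  length (edgeReps g ++ larger)  ≡⟨ length-++ (edgeReps g) ⟩
  length (edgeReps g) + length larger ≤⟨ ℕₚ.+-monoʳ-≤ (length (edgeReps g)) larger-≤ ⟩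
  length (edgeReps g) + length (edgeReps g) ≡⟨ cong (length (edgeReps g) ℕ.+_) (ℕₚ.+-identityʳ _) ⟨
  2 * length (edgeReps g)        ≡⟨ ℕₚ.*-comm 2 (length (edgeReps g)) ⟩
  length (edgeReps g) * 2        ∎
  where
  open ℕₚ.≤-Reasoning
  open IsCubic cubic
  smaller? : ∀ h → Dec (toℕ h < toℕ (mate g h))
  smaller? h = toℕ h <? toℕ (mate g h)
  larger? : ∀ h → Dec (toℕ (mate g h) < toℕ h)
  larger? h = toℕ (mate g h) <? toℕ h
  larger = filter larger? (allFin (6 * n))
  covered : ∀ h → h ∈ edgeReps g ++ larger
  covered h with ℕₚ.<-cmp (toℕ h) (toℕ (mate g h))
  ... | tri< lt _ _ = ∈-++⁺ˡ (∈-count smaller? lt)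
  ... | tri≈ _ eq _ = ⊥-elim (mate-nofix h (sym (toℕ-injective eq)))
  ... | tri> _ _ gt = ∈-++⁺ʳ (edgeReps g) (∈-count larger? gt)
  larger-≤ : length larger ≤ length (edgeReps g)
  larger-≤ = count-injective larger? smaller? (mate g)
    (λ eq → trans (sym (mate-invol _)) (trans (cong (mate g) eq) (mate-invol _)))
    (λ h gt → subst (toℕ (mate g h) <_) (cong toℕ (sym (mate-invol h))) gt)

minimumℚ-≤ : ∀ {q qs} → q ∈ qs → Σ ℚ λ m → minimumℚ qs ≡ just m × m ℚ.≤ q
minimumℚ-≤ {q} {_ ∷ qs} (here refl) with minimumℚ qs
... | nothing = q , refl , ℚₚ.≤-refl
... | just m = q ⊓ m , refl , ℚₚ.p⊓q≤p q m
minimumℚ-≤ {q} {p ∷ qs} (there q∈) with minimumℚ qs | minimumℚ-≤ q∈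
... | just m | m , refl , m≤q = p ⊓ m , refl , ℚₚ.≤-trans (ℚₚ.p⊓q≤q p m) m≤q

∈-allSubsets : ∀ {k} (S : Subset k) → S ∈ allSubsets k
∈-allSubsets [] = here refl
∈-allSubsets {suc k} (true ∷ S) = ∈-++⁺ˡ (∈-map⁺ (inside ∷_) (∈-allSubsets S))
∈-allSubsets {suc k} (false ∷ S) = ∈-++⁺ʳ (map (inside ∷_) (allSubsets k)) (∈-map⁺ (outside ∷_) (∈-allSubsets S))

lookup-complement : ∀ {k} (S : Subset k) x → lookup (complement S) x ≡ not (lookup S x)
lookup-complement (s ∷ S) zero = refl
lookup-complement (s ∷ S) (suc x) = lookup-complement S x

∈-properNonempty : ∀ {k} (S : Subset k) {x y} → lookup S x ≡ true → lookup S y ≡ false → S ∈ properNonempty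
∈-properNonempty {k} S {x} {y} x∈ y∉ = ∈-filter⁺ (λ S → ¬? (∣ S ∣ ℕ.≟ 0)) (∈-filter⁺ (λ S → ¬? (∣ S ∣ ℕ.≟ k)) (∈-allSubsets S) proper) nonempty
  where
  proper : ∣ S ∣ ≢ k
  proper eq with () ← trans (sym y∉) (trans (cong (λ S → lookup S y) (∣p∣≡n⇒p≡⊤ {p = S} eq)) (lookup-replicate y true))
  nonempty : ∣ S ∣ ≢ 0
  nonempty eq = ℕₚ.n≮0 (ℕₚ.<-≤-trans (x∈p⇒∣p-x∣<∣p∣ {p = S} (lookup⇒[]= x S x∈)) (ℕₚ.≤-reflexive eq))

ratio-small : ∀ ε → 0ℚ ℚ.< ε → Σ ℕ λ N → ∀ {n} → N ≤ n → ∀ {b v} → 1 ≤ v → n * b ≤ 2 * v → ratio b v ℚ.< ε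
ratio-small (mkℚ (+ zero) q _) (ℚ.*<* (+<+ ()))
ratio-small (mkℚ (ℤ.-[1+ _ ]) q _) (ℚ.*<* ())
-- The hypothesis means `b / v ≤ 2 / n`, and `n > 2 * suc q` puts this below `1 / suc q`, which is
-- at most `δ`.
ratio-small δ@(mkℚ (+ suc p) q _) _ = suc (2 * suc q) , small
  where
  small : ∀ {n} → suc (2 * suc q) ≤ n → ∀ {b v} → 1 ≤ v → n * b ≤ 2 * v → ratio b v ℚ.< δ
  small {n} n≥ {b} {suc v} _ nb≤ = ℚₚ.toℚᵘ-cancel-< (ℚᵘₚ.<-respˡ-≃ (ℚᵘₚ.≃-sym (ℚₚ.toℚᵘ-fromℚᵘ (mkℚᵘ (+ b) v)))
    (*<* (subst₂ ℤ._<_ (ℤₚ.pos-* b (suc q)) (ℤₚ.pos-* (suc p) (suc v)) (+<+ (ℕₚ.<-≤-trans (bound b nb≤) (ℕₚ.m≤m+n (suc v) (p * suc v)))))))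
    where
    bound : ∀ b → n * b ≤ 2 * suc v → b * suc q < suc v
    bound zero _ = s≤s z≤n
    bound b@(suc _) nb≤ = ℕₚ.*-cancelˡ-< 2 (b * suc q) (suc v) (begin-strict
      2 * (b * suc q)       ≡⟨ cong (2 *_) (ℕₚ.*-comm b (suc q)) ⟩
      2 * (suc q * b)       ≡⟨ ℕₚ.*-assoc 2 (suc q) b ⟨
      2 * suc q * b         <⟨ ℕₚ.*-monoˡ-< b (ℕₚ.≤-refl {suc (2 * suc q)}) ⟩
      suc (2 * suc q) * b   ≤⟨ ℕₚ.*-monoˡ-≤ b n≥ ⟩
      n * b                 ≤⟨ nb≤ ⟩
      2 * suc v             ∎)
      where open ℕₚ.≤-Reasoning

module Conductance {n : ℕ} (P : ClassPresentation n) (1≤n : 1 ≤ n) where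
  open ClassPresentation P
  open Reach P using (rep-iso)

  Γ-degree : ∀ x → 6 * n ≤ length (Γ P x)
  Γ-degree x = ℕₚ.≤-trans (edgeReps-length (rep x) (proj₁ (rep-ok x)))
    (ℕₚ.≤-reflexive (sym (concatMap-pairs-length _ _ (edgeReps (rep x)))))

  Decides : Subset k → (RawCubic n → Set) → Set
  Decides S Q = (∀ x → lookup S x ≡ true → Q (rep x)) × (∀ x → Q (rep x) → lookup S x ≡ true)

  out? : (S : Subset k) → ∀ y → Dec (lookup S y ≡ false)
  out? S y = lookup S y Bool.≟ false

  in? : (S : Subset k) → ∀ y → Dec (lookup S y ≡ true)
  in? S y = lookup S y Bool.≟ true

  -- Membership in `S` is decided at representatives, so the property of a moved graph is first
  -- transferred, by invariance, to the representative of its class.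
  leaving-moves : ∀ {Q} → Robust Q → ∀ S → Decides S Q → ∀ x → lookup S x ≡ true →
    length (filter (out? S) (Γ P x)) ≤ 12
  leaving-moves {Q} robust S (sound , complete) x x∈ with Robust.stable robust (rep x) (rep-ok x) (sound x x∈)
  ... | hs , hs≤6 , stays = ℕₚ.≤-trans
    (filter-pairs-length (out? S) (_∈? hs) _ _ (λ h h∉ → (remains false h h∉ , remains true h h∉)) (edgeReps g))
    (ℕₚ.*-monoˡ-≤ 2 (ℕₚ.≤-trans (unique-⊆-length unique (λ h∈ → proj₂ (∈-filter⁻ (_∈? hs) {xs = edgeReps g} h∈))) hs≤6))
    where
    open DecMembership (_≟_ {6 * n}) using (_∈?_)
    g = rep x
    unique = Uniq.filter⁺ (_∈? hs) (count-unique (λ h → toℕ h <? toℕ (mate g h)))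
    remains : ∀ s h → h ∉ hs → lookup S (cls (whitehead s g h)) ≢ false
    remains s h h∉ out with () ← trans (sym (complete _ (Robust.invariant robust (whitehead s g h) _
      (rep-iso _ (whitehead-connectedCubic (rep-ok x) s h)) (stays s h h∉)))) out

  boundary-vol : ∀ {Q} → Robust Q → ∀ S → Decides S Q → n * boundary (Γ P) S ≤ 2 * vol (Γ P) S
  boundary-vol robust S decides = sumOver-scale n 2 _ _ (filter (in? S) (allFin _)) λ {x} x∈ → begin
    n * length (filter (out? S) (Γ P x)) ≤⟨ ℕₚ.*-monoʳ-≤ n (leaving-moves robust S decides x (proj₂ (∈-filter⁻ (in? S) {xs = allFin k} x∈))) ⟩
    n * 12                               ≡⟨ ℕₚ.*-comm n 12 ⟩
    2 * 6 * n                            ≡⟨ ℕₚ.*-assoc 2 6 n ⟩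
    2 * (6 * n)                          ≤⟨ ℕₚ.*-monoʳ-≤ 2 (Γ-degree x) ⟩
    2 * length (Γ P x)                   ∎
    where open ℕₚ.≤-Reasoning

  -- Of two disjoint sets, the one of smaller volume has at most half of the total volume.
  phiOut-≤ : ∀ {Q} → Robust Q → ∀ S S′ → Decides S Q → (∀ x → lookup S′ x ≡ true → lookup S x ≡ false) →
    ∀ {x y} → lookup S x ≡ true → lookup S′ y ≡ true → vol (Γ P) S ≤ vol (Γ P) S′ →
    Σ ℚ λ φ → Σ ℕ λ b → Σ ℕ λ v → phiOut (Γ P) ≡ just φ × φ ℚ.≤ ratio b v × 1 ≤ v × n * b ≤ 2 * v
  phiOut-≤ robust S S′ decides disjoint {x} {y} x∈ y∈ vol≤ =
    let φ , eq , φ≤ = minimumℚ-≤ (∈-map⁺ (phiOutSet (Γ P)) (∈-properNonempty S x∈ (disjoint y y∈)))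
    in φ , boundary (Γ P) S , vol (Γ P) S , eq , subst (λ v → φ ℚ.≤ ratio (boundary (Γ P) S) v) (ℕₚ.m≤n⇒m⊓n≡m vol≤ᶜ) φ≤
     , ℕₚ.≤-trans (ℕₚ.≤-trans (ℕₚ.≤-trans 1≤n (ℕₚ.m≤m+n n _)) (Γ-degree x)) (sumOver-∈ _ (∈-count (in? S) x∈))
     , boundary-vol robust S decides
    where
    vol≤ᶜ : vol (Γ P) S ≤ vol (Γ P) (complement S)
    vol≤ᶜ = ℕₚ.≤-trans vol≤ (sumOver-filter-≤ _ (in? S′) (in? (complement S))
      (λ z z∈ → trans (lookup-complement S z) (cong not (disjoint z z∈))) (allFin k))

  module Disjoint {Q Q′ : RawCubic n → Set} (robust : Robust Q) (robust′ : Robust Q′)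
    (disjoint : ∀ x → Q (rep x) → Q′ (rep x) → ⊥) {g g′ : RawCubic n} (cc : ConnectedCubic g) (cc′ : ConnectedCubic g′)
    (q : Q g) (q′ : Q′ g′) where

    -- Double negation commutes with a finite conjunction.
    ∀-¬¬ : ∀ k {R : Fin k → Set} → (∀ i → ¬ ¬ R i) → ¬ ¬ (∀ i → R i)
    ∀-¬¬ zero _ none = none (λ ())
    ∀-¬¬ (suc k) ¬¬R none = ¬¬R zero (λ r → ∀-¬¬ k (¬¬R ∘ suc) (λ rs → none (λ { zero → r ; (suc i) → rs i })))

    -- A `Subset` needs Boolean membership, whereas the kinds assert the existence of a colouring;
    -- excluded middle is available under a double negation.
    deciding : ¬ ¬ (∀ x → Dec (Q (rep x)) × Dec (Q′ (rep x)))
    deciding = ∀-¬¬ k λ x none → ¬¬-excluded-middle λ d → ¬¬-excluded-middle λ d′ → none (d , d′)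

    toSubset : {R : Fin k → Set} → (∀ x → Dec (R x)) → Subset k
    toSubset R? = tabulate (does ∘ R?)

    toSubset-decides : {R : RawCubic n → Set} (R? : ∀ x → Dec (R (rep x))) → Decides (toSubset R?) R
    toSubset-decides R? = (λ x eq → sound (R? x) (trans (sym (lookup∘tabulate _ x)) eq))
      , λ x Rx → trans (lookup∘tabulate _ x) (dec-true (R? x) Rx)
      where
      sound : {R : Set} (d : Dec R) → does d ≡ true → R
      sound (yes r) _ = r

    excluded : {R R′ : RawCubic n → Set} → (∀ x → R (rep x) → R′ (rep x) → ⊥) → ∀ {S S′} → Decides S R → Decides S′ R′ →
      ∀ x → lookup S′ x ≡ true → lookup S x ≡ false
    excluded apart {S} (sound , _) (sound′ , _) x x∈ with lookup S x in eq
    ... | true = ⊥-elim (apart x (sound x eq) (sound′ x x∈))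
    ... | false = refl

    bounded : ¬ ¬ (Σ ℚ λ φ → Σ ℕ λ b → Σ ℕ λ v → phiOut (Γ P) ≡ just φ × φ ℚ.≤ ratio b v × 1 ≤ v × n * b ≤ 2 * v)
    bounded none = deciding λ d →
      let S = toSubset (proj₁ ∘ d) ; S′ = toSubset (proj₂ ∘ d)
          dS = toSubset-decides {Q} (proj₁ ∘ d) ; dS′ = toSubset-decides {Q′} (proj₂ ∘ d)
          x∈ = proj₂ dS (cls g) (Robust.invariant robust g _ (rep-iso g cc) q)
          y∈ = proj₂ dS′ (cls g′) (Robust.invariant robust′ g′ _ (rep-iso g′ cc′) q′)
      in none (by-volume {S} {S′} dS dS′ x∈ y∈ (ℕₚ.≤-total (vol (Γ P) S) (vol (Γ P) S′)))
      where
      by-volume : ∀ {S S′ x y} → Decides S Q → Decides S′ Q′ → lookup S x ≡ true → lookup S′ y ≡ true →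
        vol (Γ P) S ≤ vol (Γ P) S′ ⊎ vol (Γ P) S′ ≤ vol (Γ P) S → _
      by-volume {S} {S′} dS dS′ x∈ y∈ (inj₁ le) = phiOut-≤ robust S S′ dS (excluded {Q} {Q′} disjoint {S} {S′} dS dS′) x∈ y∈ le
      by-volume {S} {S′} dS dS′ x∈ y∈ (inj₂ le) = phiOut-≤ robust′ S′ S dS′ (excluded {Q′} {Q} (λ x r r′ → disjoint x r′ r) {S′} {S} dS′ dS) y∈ x∈ le

halve : ∀ m → ∃ λ b → b + b ≤ m × m ≤ suc (b + b)
halve zero = 0 , z≤n , z≤n
halve (suc zero) = 0 , z≤n , s≤s z≤n
halve (suc (suc m)) with halve m
... | b , lo , hi = suc b , s≤s (ℕₚ.≤-trans (ℕₚ.≤-reflexive (ℕₚ.+-suc b b)) (s≤s lo))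
                  , s≤s (s≤s (ℕₚ.≤-trans hi (ℕₚ.≤-reflexive (sym (ℕₚ.+-suc b b)))))

-- With `b` the integer half of `n - 5`, a split with `2(b + 2)` vertices on each side fits because
-- `2b + 5 ≤ n`. Forking at beads `b` and `2b + 1` gives branches of at most `b + 1` levels once
-- `n < 3b + 3`. As `n ≤ 2b + 6`, this needs `b ≥ 4`, which is where 13 comes from.
phiOut-bound : ∀ {n} (P : ClassPresentation n) → 13 ≤ n →
  ¬ ¬ (Σ ℚ λ φ → Σ ℕ λ b → Σ ℕ λ v → phiOut (Γ P) ≡ just φ × φ ℚ.≤ ratio b v × 1 ≤ v × n * b ≤ 2 * v)
phiOut-bound {suc n′} P 13≤n = Disjoint.bounded Split-robust Tripod-robust
    (λ x → Split-Tripod-disjoint (rep-ok x) (ℕₚ.*-monoʳ-< 2 (ℕₚ.≤-refl {suc (suc b)})))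
    beads-connectedCubic fork-connectedCubic (beads-split (suc (suc b)) room-split)
    (fork-tripod c-room d-room n-room)
  where
  open ClassPresentation P
  open Conductance P (s≤s z≤n)
  open Beads n′
  open ℕₚ.≤-Reasoning
  r = n′ ∸ 4
  b = proj₁ (halve r)
  lo = proj₁ (proj₂ (halve r))
  hi = proj₂ (proj₂ (halve r))
  n′≡ : r + 4 ≡ n′
  n′≡ = ℕₚ.m∸n+n≡m (ℕₚ.≤-trans (ℕₚ.m≤m+n 4 8) (ℕₚ.≤-pred 13≤n))
  4≤b : 4 ≤ b
  4≤b = ℕₚ.≮⇒≥ λ b<4 → ℕₚ.<⇒≱ (s≤s (ℕₚ.+-mono-≤ (ℕₚ.≤-pred b<4) (ℕₚ.≤-pred b<4)))
    (ℕₚ.≤-pred (ℕₚ.≤-trans (ℕₚ.∸-monoˡ-≤ 4 (ℕₚ.≤-pred 13≤n)) hi))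
  room-split : suc (suc b) + suc (suc (suc b)) ≤ suc n′
  room-split = begin
    suc (suc b) + suc (suc (suc b)) ≡⟨ ℕₚ.+-comm (suc (suc b)) (suc (suc (suc b))) ⟩
    3 + (b + (2 + b))               ≡⟨ cong (3 ℕ.+_) (ℕₚ.+-comm b (2 + b)) ⟩
    5 + (b + b)                     ≤⟨ ℕₚ.+-monoʳ-≤ 5 lo ⟩
    5 + r                           ≡⟨ cong suc (ℕₚ.+-comm 4 r) ⟩
    suc (r + 4)                     ≡⟨ cong suc n′≡ ⟩
    suc n′                          ∎
  d<n : suc (b + b) < suc n′
  d<n = ℕₚ.≤-trans (s≤s (s≤s (ℕₚ.≤-trans (ℕₚ.+-monoʳ-≤ b (ℕₚ.m≤n+m b 3))
    (ℕₚ.+-monoˡ-≤ (3 + b) ℕₚ.≤-refl)))) room-split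
  c<n : b < suc n′
  c<n = ℕₚ.<-trans (s≤s (ℕₚ.m≤m+n b b)) d<n
  c = fromℕ< c<n
  d = fromℕ< d<n
  c≡ : toℕ c ≡ b
  c≡ = toℕ-fromℕ< c<n
  d≡ : toℕ d ≡ suc (b + b)
  d≡ = toℕ-fromℕ< d<n
  open Fork P c d (subst₂ _<_ (sym c≡) (sym d≡) (s≤s (ℕₚ.m≤m+n b b)))
  c-room : toℕ c < suc b
  c-room = s≤s (ℕₚ.≤-reflexive c≡)
  d-room : toℕ d < suc (toℕ c) + suc b
  d-room = subst₂ (λ c d → d < suc c + suc b) (sym c≡) (sym d≡) (s≤s (ℕₚ.≤-reflexive (sym (ℕₚ.+-suc b b))))
  n-room : suc n′ < suc (toℕ d) + suc b
  n-room = subst (λ d → suc n′ < suc d + suc b) (sym d≡) (begin-strict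
    suc n′                  ≡⟨ cong suc n′≡ ⟨
    suc (r + 4)             ≤⟨ s≤s (ℕₚ.+-mono-≤ hi 4≤b) ⟩
    suc (suc (b + b) + b)   <⟨ ℕₚ.≤-refl ⟩
    2 + (suc (b + b) + b)   ≡⟨ cong (2 ℕ.+_) (ℕₚ.+-suc (b + b) b) ⟨
    suc (suc (b + b)) + suc b ∎)

phiOut-small : (P : (n : ℕ) → ClassPresentation n) → (ε : ℚ) → 0ℚ ℚ.< ε → Σ ℕ λ N → (n : ℕ) → N ≤ n →
  Σ ℚ λ φ → (phiOut (Γ (P n)) ≡ just φ) × (φ ℚ.< ε)
-- `13 + N` meets both the size needed for the examples and the threshold for `δ`; decidability of
-- the conclusion discharges the double negation.
phiOut-small P δ 0<δ = let N , small = ratio-small δ 0<δ in 13 + N , λ n N≤n → decidable-stable (small? (phiOut (Γ (P n))))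
    λ none → phiOut-bound (P n) (ℕₚ.≤-trans (ℕₚ.m≤m+n 13 N) N≤n) λ { (φ , b , v , eq , φ≤ , 1≤v , nb≤) →
      none (φ , eq , ℚₚ.≤-<-trans φ≤ (small (ℕₚ.≤-trans (ℕₚ.m≤n+m N 13) N≤n) 1≤v nb≤)) }
  where
  small? : ∀ mφ → Dec (Σ ℚ λ φ → mφ ≡ just φ × φ ℚ.< δ)
  small? nothing = no λ ()
  small? (just φ) with φ ℚₚ.<? δ
  ... | yes φ<δ = yes (φ , refl , φ<δ)
  ... | no φ≮δ = no λ { (_ , refl , φ<δ) → φ≮δ φ<δ }

not-outer-expanders : (P : (n : ℕ) → ClassPresentation n) →
  ¬ IsOuterExpanderFamily (λ n → ClassPresentation.k (P n)) (λ n → Γ (P n))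
not-outer-expanders P (c , 0<c , c≤) = let N , small = phiOut-small P c 0<c
                                           φ , eq , φ<c = small N ℕₚ.≤-refl
                                       in ℚₚ.<-irrefl refl (ℚₚ.≤-<-trans (c≤ N φ eq) φ<c)

theorem2p2 : (P : (n : ℕ) → ClassPresentation n) →
    ((n : ℕ) → 1 ≤ n → DiConnected (Γ (P n))) ×
    ((ε : ℚ) → 0ℚ ℚ.< ε → Σ ℕ λ N → (n : ℕ) → N ≤ n →
    Σ ℚ λ φ → (phiOut (Γ (P n)) ≡ just φ) × (φ ℚ.< ε)) ×
    ¬ IsOuterExpanderFamily (λ n → ClassPresentation.k (P n)) (λ n → Γ (P n))
theorem2p2 P = (λ n → Γ-connected (P n)) , phiOut-small P , not-outer-expanders P
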